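{- For $m,n\ge1$ let $p(m,n)$ be the number of Fibonacci polyominoes with horizontal semiperimeter $m$ and vertical semiperimeter $n$, and let $P(x,y)=\sum_{m,n\geq 1}p(m,n)x^my^n$. For $n\geq 1$, \[ [x^n]P(x,y)=\frac{y^n}{(1-y)^n}\left(yC_n + (1-y)C_{n-1}\right), \] where $C_k=\frac{1}{k+1}\binom{2k}{k}$ is the $k$th Catalan number.
   Context: A Fibonacci polyomino is a (nonempty) polyomino, considered up to translation, that is column-convex (each column is a contiguous segment of unit cells) and such that, reading columns from left to right, the bottom cell of each column lies exactly one unit above the bottom cell of the preceding column. Equivalently, it is given by a sequence of column heights $(h_1,\dots,h_m)$, $m\ge 1$, with $h_i\ge 2$ for $1\le i\le m-1$ and $h_m\ge 1$; column $i$ consists of the cells in column position $i$ and rows $i,i+1,\dots,i+h_i-1$. The horizontal (resp. vertical) semiperimeter of a polyomino is half the number of horizontal (resp. vertical) unit edges on its boundary (a boundary edge is a unit edge belonging to exactly one cell). $[x^n]P(x,y)$ denotes the coefficient of $x^n$, a formal power series in $y$. -}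

module Defs where

open import Data.Integer as ℤ using (ℤ; +_; 0ℤ; 1ℤ)
import Data.Integer.Properties as ℤₚ
open import Data.List using (List; []; _∷_; _++_; map; concatMap; filter; length; upTo)
import Data.List.Membership.DecPropositional as DecMembership
open import Data.Nat using (ℕ; zero; suc; _+_; _*_; _∸_; _/_; _≤_; _≟_)
open import Data.Nat.Combinatorics using (_C_; nC1≡n; nCk+nC[k+1]≡[n+1]C[k+1])
open import Data.Nat.DivMod using (m/n*n≡m)
open import Data.Nat.Divisibility using (_∣_; divides; m∣m*n; ∣m+n∣m⇒∣n)
import Data.Nat.Properties as ℕₚ
open import Data.Nat.Tactic.RingSolver using (solve-∀)
open import Data.Fin using (Fin)
open import Data.Product using (_×_; _,_)
open import Data.Product.Properties using (≡-dec)
open import Data.Vec using (Vec; []; _∷_; head)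
open import Function using (_∘_)
open import Function.Bundles using (_↔_)
open import Relation.Binary.PropositionalEquality using (_≡_; refl; sym; trans; cong; cong₂; module ≡-Reasoning)

-- Column heights, left to right: nonempty, every height but the last is at
-- least 2, the last is at least 1.  (There is no case for the empty list, so
-- the tail in the second constructor is nonempty.)
data FibonacciHeights : List ℕ → Set where
  last : ∀ {h} → 1 ≤ h → FibonacciHeights (h ∷ [])
  next : ∀ {h hs} → 2 ≤ h → FibonacciHeights hs → FibonacciHeights (h ∷ hs)

-- The cell (c , r), in column c and row r, is the square [c , c+1] × [r , r+1].
Cell : Set
Cell = ℕ × ℕ

-- Cells of consecutive columns, the first of which is column i: a column of
-- height h in position i occupies the rows i , i + 1 , … , i + h - 1.
cellsFrom : ℕ → List ℕ → List Cell
cellsFrom i []       = []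
cellsFrom i (h ∷ hs) = map (λ r → i , i + r) (upTo h) ++ cellsFrom (suc i) hs

cells : List ℕ → List Cell
cells = cellsFrom 1

-- A horizontal unit edge is named by its left endpoint, a vertical one by its
-- lower endpoint.
Edge : Set
Edge = ℕ × ℕ

open DecMembership (≡-dec _≟_ _≟_) using (_∈?_)

horizontalSides : Cell → List Edge
horizontalSides (c , r) = (c , r) ∷ (c , suc r) ∷ []

verticalSides : Cell → List Edge
verticalSides (c , r) = (c , r) ∷ (suc c , r) ∷ []

cellsAt : (Cell → List Edge) → List Cell → Edge → ℕ
cellsAt sides cs e = length (filter (λ c → e ∈? sides c) cs)

-- The edges belonging to exactly one cell.  In the list of the sides of all
-- cells such an edge occurs once (an edge shared by two cells occurs twice,
-- and is removed), so for a duplicate-free list of cells the result is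
-- duplicate-free.
boundary : (Cell → List Edge) → List Cell → List Edge
boundary sides cs = filter (λ e → cellsAt sides cs e ≟ 1) (concatMap sides cs)

-- The semiperimeters are half the number of boundary edges of each direction.
record FibonacciPolyomino (m n : ℕ) : Set where
  field
    heights        : List ℕ
    fibonacci      : FibonacciHeights heights
    horizontalSemi : length (boundary horizontalSides (cells heights)) ≡ 2 * m
    verticalSemi   : length (boundary verticalSides (cells heights)) ≡ 2 * n

CountsFibonacciPolyominoes : (ℕ → ℕ → ℕ) → Set
CountsFibonacciPolyominoes p =
  ∀ m n → 1 ≤ m → 1 ≤ n → Fin (p m n) ↔ FibonacciPolyomino m n

-- Formal power series in y over ℤ, by coefficients.
Series : Set
Series = ℕ → ℤ

infix  4 _≈_
infixl 6 _⊕_ _⊖_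
infixl 7 _⊛_ _⊘_
infixr 8 _^ˢ_

_≈_ : Series → Series → Set
f ≈ g = ∀ k → f k ≡ g k

const : ℤ → Series
const a zero    = a
const a (suc _) = 0ℤ

y : Series
y 1 = 1ℤ
y _ = 0ℤ

_⊕_ _⊖_ : Series → Series → Series
(f ⊕ g) k = f k ℤ.+ g k
(f ⊖ g) k = f k ℤ.- g k

sumTo : ℕ → (ℕ → ℤ) → ℤ
sumTo zero    f = f 0
sumTo (suc n) f = f 0 ℤ.+ sumTo n (f ∘ suc)

_⊛_ : Series → Series → Series
(f ⊛ g) n = sumTo n (λ i → f i ℤ.* g (n ∸ i))

_^ˢ_ : Series → ℕ → Series
f ^ˢ zero  = const 1ℤ
f ^ˢ suc n = f ⊛ f ^ˢ n

dot : (ℕ → ℤ) → ∀ {n} → Vec ℤ (suc n) → ℤ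
dot f (x ∷ [])         = f 0 ℤ.* x
dot f (x ∷ xs@(_ ∷ _)) = f 0 ℤ.* x ℤ.+ dot (f ∘ suc) xs

-- The coefficients b n , … , b 0 of the inverse of a series f with f 0 = 1:
-- b 0 = 1 and b (n+1) = - (f 1 · b n + f 2 · b (n-1) + ⋯ + f (n+1) · b 0).
recipCoeffs : Series → ∀ n → Vec ℤ (suc n)
recipCoeffs f zero    = 1ℤ ∷ []
recipCoeffs f (suc n) = (ℤ.- dot (f ∘ suc) (recipCoeffs f n)) ∷ recipCoeffs f n

-- Meaningful only when f 0 = 1; see recip-inverse.
recip : Series → Series
recip f n = head (recipCoeffs f n)

_⊘_ : Series → Series → Series
f ⊘ g = f ⊛ recip g

dot-recipCoeffs : ∀ (g : ℕ → ℤ) f n →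
  dot g (recipCoeffs f n) ≡ sumTo n (λ i → g i ℤ.* recip f (n ∸ i))
dot-recipCoeffs g f zero          = refl
dot-recipCoeffs g f (suc zero)    = refl
dot-recipCoeffs g f (suc (suc n)) =
  cong (λ s → g 0 ℤ.* recip f (suc (suc n)) ℤ.+ s) (dot-recipCoeffs (g ∘ suc) f (suc n))

recip-inverse : ∀ f → f 0 ≡ 1ℤ → f ⊛ recip f ≈ const 1ℤ
recip-inverse f f₀ zero    = trans (ℤₚ.*-identityʳ (f 0)) f₀
recip-inverse f f₀ (suc n) = begin
  f 0 ℤ.* (ℤ.- d) ℤ.+ s   ≡⟨ cong (λ a → a ℤ.* (ℤ.- d) ℤ.+ s) f₀ ⟩
  1ℤ ℤ.* (ℤ.- d) ℤ.+ s    ≡⟨ cong (ℤ._+ s) (ℤₚ.*-identityˡ (ℤ.- d)) ⟩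
  (ℤ.- d) ℤ.+ s           ≡⟨ cong (λ t → (ℤ.- d) ℤ.+ t) (sym (dot-recipCoeffs (f ∘ suc) f n)) ⟩
  (ℤ.- d) ℤ.+ d           ≡⟨ ℤₚ.+-inverseˡ d ⟩
  0ℤ                      ∎
  where
  open ≡-Reasoning
  d = dot (f ∘ suc) (recipCoeffs f n)
  s = sumTo n (λ i → f (suc i) ℤ.* recip f (n ∸ i))

^ˢ-constant-term : ∀ f n → f 0 ≡ 1ℤ → (f ^ˢ n) 0 ≡ 1ℤ
^ˢ-constant-term f zero    f₀ = refl
^ˢ-constant-term f (suc n) f₀ = cong₂ ℤ._*_ f₀ (^ˢ-constant-term f n f₀)

-- Formal power series in x whose coefficients are series in y.
BiSeries : Set
BiSeries = ℕ → Series

[x^_]_ : ℕ → BiSeries → Series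
[x^ n ] P = P n

-- ∑_{m,n ≥ 1} p(m,n) x^m y^n
generatingFunction : (ℕ → ℕ → ℕ) → BiSeries
generatingFunction p zero    _       = 0ℤ
generatingFunction p (suc _) zero    = 0ℤ
generatingFunction p (suc m) (suc n) = + p (suc m) (suc n)

-- The division is exact; see catalan-exact.
catalan : ℕ → ℕ
catalan k = ((2 * k) C k) / suc k

absorption : ∀ n j → suc j * (n C suc j) + j * (n C j) ≡ n * (n C j)
absorption zero    zero    = refl
absorption zero    (suc j) = cong₂ _+_ (ℕₚ.*-zeroʳ j) (ℕₚ.*-zeroʳ j)
absorption (suc n) zero    =
  trans (cong (λ a → 1 * a + 0) (nC1≡n (suc n))) (lemma n)
  where
  lemma : ∀ n → 1 * suc n + 0 ≡ suc n * 1
  lemma = solve-∀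
absorption (suc n) (suc i) = begin
  suc (suc i) * (suc n C suc (suc i)) + suc i * (suc n C suc i)
    ≡⟨ cong₂ (λ u v → suc (suc i) * u + suc i * v)
         (sym (nCk+nC[k+1]≡[n+1]C[k+1] n (suc i))) (sym (nCk+nC[k+1]≡[n+1]C[k+1] n i)) ⟩
  suc (suc i) * (b + c) + suc i * (a + b)
    ≡⟨ regroup i a b c ⟩
  (suc (suc i) * c + suc i * b) + (suc i * b + i * a) + (a + b)
    ≡⟨ cong₂ (λ u v → u + v + (a + b)) (absorption n (suc i)) (absorption n i) ⟩
  n * b + n * a + (a + b)
    ≡⟨ collect n a b ⟩
  suc n * (a + b)
    ≡⟨ cong (suc n *_) (nCk+nC[k+1]≡[n+1]C[k+1] n i) ⟩
  suc n * (suc n C suc i) ∎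
  where
  open ≡-Reasoning
  a = n C i
  b = n C suc i
  c = n C suc (suc i)
  regroup : ∀ i a b c → suc (suc i) * (b + c) + suc i * (a + b)
          ≡ (suc (suc i) * c + suc i * b) + (suc i * b + i * a) + (a + b)
  regroup = solve-∀
  collect : ∀ n a b → n * b + n * a + (a + b) ≡ suc n * (a + b)
  collect = solve-∀

catalan-exact : ∀ k → catalan k * suc k ≡ (2 * k) C k
catalan-exact k = m/n*n≡m (∣m+n∣m⇒∣n divisible (m∣m*n a))
  where
  a = (2 * k) C suc k
  b = (2 * k) C k
  double : ∀ k b → 2 * k * b ≡ k * b + k * b
  double = solve-∀
  step : suc k * a ≡ k * b
  step = ℕₚ.+-cancelʳ-≡ (k * b) (suc k * a) (k * b) (trans (absorption (2 * k) k) (double k b))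
  expand : ∀ k b → k * b + b ≡ b * suc k
  expand = solve-∀
  divisible : suc k ∣ suc k * a + b
  divisible = divides b (trans (cong (_+ b) step) (expand k b))

{-# OPTIONS --safe #-}

-- The horizontal semiperimeter is the number of columns, and the vertical one
-- counts the left sides of cells on the boundary: h₁ + Σ (hᵢ₊₁ ∸ (hᵢ - 1)).
-- Call a profile any sequence of levels kᵢ = hᵢ - 1 ≥ 0, with the same weight, and
-- let z = y / (1 - y).  Lowering all columns by one cell shows that polyominoes
-- without a last column of height 1 are profiles with weight decreased by 1;
-- a last column of height 1 after a column of height at least 2 has no left
-- side on the boundary.  Hence P_m = y (R_m + R_{m-1}) where R_m enumerates the
-- profiles of m columns, and it remains to see that R_m = C_m z^m.
-- The operator A that prepends one column acts on functions of the level L of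
-- the preceding column.  On the functions V_j with
--   V_0 = 1,  V_j(0) = z^j,  V_{j+1}(L+1) = V_{j+1}(L) + V_j(L)
-- it acts by A V_0 = V_1 and A V_{j+1} = V_{j+2} + z A V_j.  So (A^m V_j)(0) is
-- z^{m+j} times a ballot number, which for j = 0 is C_m.

module Submission where

open import Defs
open import Algebra.Bundles using (CommutativeSemiring)
import Algebra.Solver.Ring.NaturalCoefficients.Default as SemiringSolver
open import Algebra.Structures.Biased using (isCommutativeSemiringˡ)
open import Data.Bool using (Bool; true; false; if_then_else_)
open import Data.Empty using (⊥)
open import Data.Fin using (Fin)
open import Data.Fin.Properties using (0↔⊥; 1↔⊤; +↔⊎)
open import Data.List using (List; []; _∷_; _++_; map; concatMap; filter; length; upTo; applyUpTo)
open import Data.List.Membership.Propositional using (_∈_)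
open import Data.List.Membership.Propositional.Properties using (∈-map⁻; ∈-++⁻)
import Data.List.Membership.DecPropositional as DecMembership
open import Data.List.Properties using (map-++; length-map; length-++; length-upTo; ∷-injectiveˡ; ∷-injectiveʳ)
open import Data.List.Relation.Unary.All as All using (All; []; _∷_)
open import Data.List.Relation.Unary.Any using (here; there)
open import Data.List.Relation.Unary.Unique.Propositional using (Unique; []; _∷_)
import Data.List.Relation.Unary.Unique.Propositional.Properties as Unique
open import Data.Nat using (ℕ; zero; suc; _+_; _*_; _∸_; _≤_; _<_; _⊓_; _≟_; _<?_; pred; z≤n; s≤s)
open import Data.Nat.Combinatorics using (_C_; nCk≡nC[n∸k]; nCk+nC[k+1]≡[n+1]C[k+1])
open import Data.Nat.ListAction using (sum)
open import Data.Nat.ListAction.Properties using (sum-++)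
import Data.Nat.Properties as ℕₚ
open import Data.Nat.Tactic.RingSolver using (solve-∀)
open import Data.Product using (Σ-syntax; ∃-syntax; _×_; _,_; proj₁; proj₂)
open import Data.Product.Properties using (≡-dec; ,-injectiveʳ)
open import Data.Sum using (_⊎_; inj₁; inj₂)
open import Data.Sum.Function.Propositional using (_⊎-↔_)
open import Data.Unit using (⊤; tt)
open import Function using (_∘_; id)
open import Function.Bundles using (_↔_; mk↔ₛ′)
open import Function.Construct.Composition using (_↔-∘_)
open import Level using (0ℓ)
open import Relation.Binary.Definitions using (DecidableEquality)
open import Relation.Binary.PropositionalEquality using (_≡_; _≢_; refl; sym; trans; cong; cong₂; subst; module ≡-Reasoning)
import Relation.Binary.Reasoning.Setoid as SetoidReasoning
open import Relation.Binary.Structures using (IsEquivalence)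
open import Relation.Nullary using (¬_; Dec; yes; no; does; contradiction)


-- Boundary edges

private variable
  A B : Set

-- Finite sums over lists and indicator values.

infix 5 ∑-syntax
∑ : List A → (A → ℕ) → ℕ
∑ xs f = sum (map f xs)

∑-syntax = ∑
syntax ∑-syntax xs (λ x → e) = ∑[ x ∈ xs ] e

∑-cong : ∀ (xs : List A) {f g} → (∀ x → x ∈ xs → f x ≡ g x) → ∑ xs f ≡ ∑ xs g
∑-cong []       eq = refl
∑-cong (x ∷ xs) eq = cong₂ _+_ (eq x (here refl)) (∑-cong xs (λ x′ i → eq x′ (there i)))

∑-zero : ∀ (xs : List A) {f} → (∀ x → x ∈ xs → f x ≡ 0) → ∑ xs f ≡ 0
∑-zero []       eq = refl
∑-zero (x ∷ xs) eq = cong₂ _+_ (eq x (here refl)) (∑-zero xs (λ x′ i → eq x′ (there i)))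

∑-one : ∀ (xs : List A) → (∑[ x ∈ xs ] 1) ≡ length xs
∑-one []       = refl
∑-one (x ∷ xs) = cong suc (∑-one xs)

∑-+ : ∀ (xs : List A) f g → (∑[ x ∈ xs ] (f x + g x)) ≡ ∑ xs f + ∑ xs g
∑-+ []       f g = refl
∑-+ (x ∷ xs) f g = trans (cong (f x + g x +_) (∑-+ xs f g)) (interchange (f x) (g x) _ _)
  where
  interchange : ∀ a b c d → a + b + (c + d) ≡ (a + c) + (b + d)
  interchange = solve-∀

∑-++ : ∀ (xs ys : List A) f → ∑ (xs ++ ys) f ≡ ∑ xs f + ∑ ys f
∑-++ xs ys f = trans (cong sum (map-++ f xs ys)) (sum-++ (map f xs) (map f ys))

∑-map : ∀ (g : A → B) xs f → ∑ (map g xs) f ≡ ∑ xs (f ∘ g)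
∑-map g []       f = refl
∑-map g (x ∷ xs) f = cong (f (g x) +_) (∑-map g xs f)

∑-concatMap : ∀ (g : A → List B) xs f → ∑ (concatMap g xs) f ≡ ∑[ x ∈ xs ] ∑ (g x) f
∑-concatMap g []       f = refl
∑-concatMap g (x ∷ xs) f = trans (∑-++ (g x) (concatMap g xs) f) (cong (∑ (g x) f +_) (∑-concatMap g xs f))

∑-swap : ∀ (xs : List A) (ys : List B) (f : A → B → ℕ) →
  (∑[ x ∈ xs ] ∑[ z ∈ ys ] f x z) ≡ (∑[ z ∈ ys ] ∑[ x ∈ xs ] f x z)
∑-swap []       ys f = sym (∑-zero ys (λ _ _ → refl))
∑-swap (x ∷ xs) ys f = trans (cong (∑ ys (f x) +_) (∑-swap xs ys f)) (sym (∑-+ ys (f x) _))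

∑-applyUpTo : ∀ (g : ℕ → A) n f → ∑ (applyUpTo g n) f ≡ ∑ (upTo n) (f ∘ g)
∑-applyUpTo g zero    f = refl
∑-applyUpTo g (suc n) f =
  cong (f (g 0) +_) (trans (∑-applyUpTo (g ∘ suc) n f) (sym (∑-applyUpTo suc n (f ∘ g))))

∑-upTo-suc : ∀ n f → ∑ (upTo (suc n)) f ≡ f 0 + ∑ (upTo n) (f ∘ suc)
∑-upTo-suc n f = cong (f 0 +_) (∑-applyUpTo suc n f)

-- The Iverson bracket. As it goes through `does`, `⟦ suc a ≟ suc b ⟧` reduces to `⟦ a ≟ b ⟧`, on
-- which the double sums over `upTo` rely.
⟦_⟧ : ∀ {P : Set} → Dec P → ℕ
⟦ d ⟧ = if does d then 1 else 0

⟦⟧-yes : ∀ {P : Set} (d : Dec P) → P → ⟦ d ⟧ ≡ 1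
⟦⟧-yes (yes _) p = refl
⟦⟧-yes (no ¬p) p = contradiction p ¬p

⟦⟧-no : ∀ {P : Set} (d : Dec P) → ¬ P → ⟦ d ⟧ ≡ 0
⟦⟧-no (yes p) ¬p = contradiction p ¬p
⟦⟧-no (no _)  ¬p = refl

⟦⟧-cong : ∀ {P Q : Set} (d : Dec P) (e : Dec Q) → (P → Q) → (Q → P) → ⟦ d ⟧ ≡ ⟦ e ⟧
⟦⟧-cong d (yes q) f g = ⟦⟧-yes d (g q)
⟦⟧-cong d (no ¬q) f g = ⟦⟧-no d (¬q ∘ f)

length-filter-∑ : ∀ {P : A → Set} (P? : ∀ x → Dec (P x)) xs → length (filter P? xs) ≡ ∑[ x ∈ xs ] ⟦ P? x ⟧
length-filter-∑ P? []       = refl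
length-filter-∑ P? (x ∷ xs) with P? x
... | yes _ = cong suc (length-filter-∑ P? xs)
... | no  _ = length-filter-∑ P? xs

_≟ᶜ_ : DecidableEquality Cell
_≟ᶜ_ = ≡-dec _≟_ _≟_

open DecMembership _≟ᶜ_ using (_∈?_)

-- Boundary edges counted through adjacent pairs of cells.

module _ (f : Cell → Cell) (f-injective : ∀ {c d} → f c ≡ f d → c ≡ d) where

  ∑-preimages≡1 : ∀ {c cs} → Unique cs → c ∈ cs → (∑[ d ∈ cs ] ⟦ f c ≟ᶜ f d ⟧) ≡ 1
  ∑-preimages≡1 {c} {_ ∷ cs} (c≢ ∷ _) (here refl) =
    cong₂ _+_ (⟦⟧-yes (f c ≟ᶜ f c) refl)
      (∑-zero cs (λ d i → ⟦⟧-no (f c ≟ᶜ f d) (All.lookup c≢ i ∘ f-injective)))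
  ∑-preimages≡1 {c} {d ∷ cs} (d≢ ∷ unique) (there i) =
    cong₂ _+_ (⟦⟧-no (f c ≟ᶜ f d) (All.lookup d≢ i ∘ sym ∘ f-injective)) (∑-preimages≡1 unique i)

  ∑-preimages≤1 : ∀ e {cs} → Unique cs → (∑[ d ∈ cs ] ⟦ e ≟ᶜ f d ⟧) ≤ 1
  ∑-preimages≤1 e {[]}     _ = z≤n
  ∑-preimages≤1 e {d ∷ cs} (d≢ ∷ unique) with e ≟ᶜ f d
  ... | yes refl = ℕₚ.≤-reflexive (cong suc (∑-zero cs (λ d′ i → ⟦⟧-no (f d ≟ᶜ f d′) (All.lookup d≢ i ∘ f-injective))))
  ... | no _     = ∑-preimages≤1 e unique

-- Every edge of a given direction is named like a cell, and the two sides of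
-- the cell c are then c and next c.
module Boundary (next : Cell → Cell)
  (next-injective : ∀ {c d} → next c ≡ next d → c ≡ d) (next-irreflexive : ∀ c → c ≢ next c) where

  sides : Cell → List Edge
  sides c = c ∷ next c ∷ []

  adjacencies : List Cell → List Cell → ℕ
  adjacencies cs ds = ∑[ c ∈ cs ] ∑[ d ∈ ds ] ⟦ next c ≟ᶜ d ⟧

  -- The two sides of a cell differ, so at most one bracket is 1 and the disjunction becomes a sum.
  ∈-sides : ∀ e c → ⟦ e ∈? sides c ⟧ ≡ ⟦ e ≟ᶜ c ⟧ + ⟦ e ≟ᶜ next c ⟧
  ∈-sides e c with e ≟ᶜ c | e ≟ᶜ next c
  ... | yes refl | yes q = contradiction q (next-irreflexive c)
  ... | yes _    | no _  = refl
  ... | no _     | yes _ = refl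
  ... | no _     | no _  = refl

  cellsAt-∑ : ∀ cs e → cellsAt sides cs e ≡ (∑[ c ∈ cs ] ⟦ e ≟ᶜ c ⟧) + (∑[ c ∈ cs ] ⟦ e ≟ᶜ next c ⟧)
  cellsAt-∑ cs e = begin
    cellsAt sides cs e                             ≡⟨ length-filter-∑ (λ c → e ∈? sides c) cs ⟩
    (∑[ c ∈ cs ] ⟦ e ∈? sides c ⟧)                 ≡⟨ ∑-cong cs (λ c _ → ∈-sides e c) ⟩
    (∑[ c ∈ cs ] (⟦ e ≟ᶜ c ⟧ + ⟦ e ≟ᶜ next c ⟧))   ≡⟨ ∑-+ cs _ _ ⟩
    _ ∎
    where open ≡-Reasoning

  private
    1+q≡1 : ∀ {k} q → q ≤ 1 → k ≡ 1 + q → ⟦ k ≟ 1 ⟧ + q ≡ 1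
    1+q≡1 .0 z≤n       refl = refl
    1+q≡1 .1 (s≤s z≤n) refl = refl

  -- The edge named `c` is the first side of `c` alone and the second side of at most one cell, so
  -- it is interior exactly when some `d` has it as second side. `boundary-second` is the mirror
  -- image.
  boundary-first : ∀ {cs c} → Unique cs → c ∈ cs →
    ⟦ cellsAt sides cs c ≟ 1 ⟧ + (∑[ d ∈ cs ] ⟦ c ≟ᶜ next d ⟧) ≡ 1
  boundary-first {cs} {c} unique c∈cs = 1+q≡1 q (∑-preimages≤1 next next-injective c unique)
    (trans (cellsAt-∑ cs c) (cong (_+ q) (∑-preimages≡1 id id unique c∈cs)))
    where q = ∑[ d ∈ cs ] ⟦ c ≟ᶜ next d ⟧

  boundary-second : ∀ {cs c} → Unique cs → c ∈ cs →
    ⟦ cellsAt sides cs (next c) ≟ 1 ⟧ + (∑[ d ∈ cs ] ⟦ next c ≟ᶜ d ⟧) ≡ 1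
  boundary-second {cs} {c} unique c∈cs = 1+q≡1 q (∑-preimages≤1 id id (next c) unique)
    (trans (cellsAt-∑ cs (next c)) (trans (cong (q +_) (∑-preimages≡1 next next-injective unique c∈cs)) (ℕₚ.+-comm q 1)))
    where q = ∑[ d ∈ cs ] ⟦ next c ≟ᶜ d ⟧

  -- Each cell lists two sides, and an edge shared by two adjacent cells is listed twice, so every
  -- adjacency removes two entries.
  length-boundary : ∀ {cs} → Unique cs →
    length (boundary sides cs) + 2 * adjacencies cs cs ≡ 2 * length cs
  length-boundary {cs} unique = begin
    length (boundary sides cs) + 2 * q
      ≡⟨ cong (_+ 2 * q) (trans (length-filter-∑ on? (concatMap sides cs)) (∑-concatMap sides cs _)) ⟩
    (∑[ c ∈ cs ] (⟦ on? c ⟧ + (⟦ on? (next c) ⟧ + 0))) + 2 * q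
      ≡⟨ cong (_+ 2 * q) (trans (∑-+ cs _ _) (cong ((∑[ c ∈ cs ] ⟦ on? c ⟧) +_)
           (∑-cong cs (λ c _ → ℕₚ.+-identityʳ ⟦ on? (next c) ⟧)))) ⟩
    (∑[ c ∈ cs ] ⟦ on? c ⟧) + (∑[ c ∈ cs ] ⟦ on? (next c) ⟧) + 2 * q
      ≡⟨ regroup (∑[ c ∈ cs ] ⟦ on? c ⟧) (∑[ c ∈ cs ] ⟦ on? (next c) ⟧) q ⟩
    ((∑[ c ∈ cs ] ⟦ on? c ⟧) + q) + ((∑[ c ∈ cs ] ⟦ on? (next c) ⟧) + q)
      ≡⟨ cong₂ _+_ first second ⟩
    length cs + length cs
      ≡⟨ cong (length cs +_) (sym (ℕₚ.+-identityʳ _)) ⟩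
    2 * length cs ∎
    where
    open ≡-Reasoning
    q = adjacencies cs cs
    on? = λ e → cellsAt sides cs e ≟ 1
    regroup : ∀ a b q → a + b + 2 * q ≡ (a + q) + (b + q)
    regroup = solve-∀
    -- `boundary-first` looks for the neighbour before `c`, `adjacencies` for the one after it;
    -- exchanging the sums reconciles them.
    transposed : q ≡ ∑[ c ∈ cs ] ∑[ d ∈ cs ] ⟦ c ≟ᶜ next d ⟧
    transposed = trans (∑-swap cs cs (λ c d → ⟦ next c ≟ᶜ d ⟧))
      (∑-cong cs (λ c _ → ∑-cong cs (λ d _ → ⟦⟧-cong (next d ≟ᶜ c) (c ≟ᶜ next d) sym sym)))
    first : (∑[ c ∈ cs ] ⟦ on? c ⟧) + q ≡ length cs
    first = trans (cong ((∑[ c ∈ cs ] ⟦ on? c ⟧) +_) transposed)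
      (trans (sym (∑-+ cs _ _)) (trans (∑-cong cs (λ c i → boundary-first unique i)) (∑-one cs)))
    second : (∑[ c ∈ cs ] ⟦ on? (next c) ⟧) + q ≡ length cs
    second = trans (sym (∑-+ cs _ _)) (trans (∑-cong cs (λ c i → boundary-second unique i)) (∑-one cs))

  adjacencies-++ : ∀ xs ys → adjacencies (xs ++ ys) (xs ++ ys)
    ≡ (adjacencies xs xs + adjacencies xs ys) + (adjacencies ys xs + adjacencies ys ys)
  adjacencies-++ xs ys = trans (∑-++ xs ys _) (cong₂ _+_ (split xs) (split ys))
    where
    split : ∀ zs → adjacencies zs (xs ++ ys) ≡ adjacencies zs xs + adjacencies zs ys
    split zs = trans (∑-cong zs (λ c _ → ∑-++ xs ys _)) (∑-+ zs _ _)

  adjacencies-disjoint : ∀ xs ys → (∀ {c d} → c ∈ xs → d ∈ ys → next c ≢ d) → adjacencies xs ys ≡ 0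
  adjacencies-disjoint xs ys apart = ∑-zero xs (λ c i → ∑-zero ys (λ d j → ⟦⟧-no (next c ≟ᶜ d) (apart i j)))

-- Adjacencies inside and between columns.

above right : Cell → Cell
above (c , r) = c , suc r
right (c , r) = suc c , r

above-injective : ∀ {c d} → above c ≡ above d → c ≡ d
above-injective refl = refl

right-injective : ∀ {c d} → right c ≡ right d → c ≡ d
right-injective refl = refl

above-irreflexive : ∀ c → c ≢ above c
above-irreflexive c ()

right-irreflexive : ∀ c → c ≢ right c
right-irreflexive c ()

-- An edge bears the name of the cell that it bounds from below or from the left, so `sides` unfolds
-- here to `horizontalSides` and `verticalSides`.
module Horizontal = Boundary above above-injective above-irreflexive
module Vertical = Boundary right right-injective right-irreflexive

column : ℕ → ℕ → List Cell
column i h = map (λ r → i , i + r) (upTo h)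

∈-column : ∀ {i h c} → c ∈ column i h → proj₁ c ≡ i
∈-column i∈ with _ , _ , refl ← ∈-map⁻ _ i∈ = refl

∈-cellsFrom : ∀ {i} hs {c} → c ∈ cellsFrom i hs → i ≤ proj₁ c
∈-cellsFrom {i} (h ∷ hs) c∈ with ∈-++⁻ (column i h) c∈
... | inj₁ c∈col  = ℕₚ.≤-reflexive (sym (∈-column {h = h} c∈col))
... | inj₂ c∈rest = ℕₚ.<⇒≤ (∈-cellsFrom hs c∈rest)

cellsFrom-unique : ∀ i hs → Unique (cellsFrom i hs)
cellsFrom-unique i []       = []
cellsFrom-unique i (h ∷ hs) = Unique.++⁺
  (Unique.map⁺ (λ eq → ℕₚ.+-cancelˡ-≡ i _ _ (,-injectiveʳ eq)) (Unique.upTo⁺ h))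
  (cellsFrom-unique (suc i) hs)
  (λ (c∈col , c∈rest) → ℕₚ.<-irrefl (sym (∈-column {h = h} c∈col)) (∈-cellsFrom hs c∈rest))

length-cellsFrom : ∀ i hs → length (cellsFrom i hs) ≡ sum hs
length-cellsFrom i []       = refl
length-cellsFrom i (h ∷ hs) = trans (length-++ (column i h))
  (cong₂ _+_ (trans (length-map _ (upTo h)) (length-upTo h)) (length-cellsFrom (suc i) hs))

∑∑-equal : ∀ m n → (∑[ a ∈ upTo m ] ∑[ b ∈ upTo n ] ⟦ a ≟ b ⟧) ≡ m ⊓ n
∑∑-equal zero    n       = refl
∑∑-equal (suc m) zero    = ∑-zero (upTo (suc m)) (λ _ _ → refl)
∑∑-equal (suc m) (suc n) = begin
  (∑[ a ∈ upTo (suc m) ] ∑[ b ∈ upTo (suc n) ] ⟦ a ≟ b ⟧)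
    ≡⟨ ∑-upTo-suc m (λ a → ∑[ b ∈ upTo (suc n) ] ⟦ a ≟ b ⟧) ⟩
  (∑[ b ∈ upTo (suc n) ] ⟦ 0 ≟ b ⟧) + (∑[ a ∈ upTo m ] ∑[ b ∈ upTo (suc n) ] ⟦ suc a ≟ b ⟧)
    ≡⟨ cong₂ _+_ (∑-upTo-suc n (λ b → ⟦ 0 ≟ b ⟧))
         (∑-cong (upTo m) (λ a _ → ∑-upTo-suc n (λ b → ⟦ suc a ≟ b ⟧))) ⟩
  suc (∑[ b ∈ upTo n ] 0) + (∑[ a ∈ upTo m ] ∑[ b ∈ upTo n ] ⟦ a ≟ b ⟧)
    ≡⟨ cong₂ (λ s t → suc s + t) (∑-zero (upTo n) (λ _ _ → refl)) (∑∑-equal m n) ⟩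
  suc (m ⊓ n) ∎
  where open ≡-Reasoning

-- The index a = 0 has no match; after the shift the sum counts the common elements of two initial
-- segments of lengths `pred m` and `n`.
∑∑-shifted : ∀ m n → (∑[ a ∈ upTo m ] ∑[ b ∈ upTo n ] ⟦ a ≟ suc b ⟧) ≡ pred m ⊓ n
∑∑-shifted zero    n = refl
∑∑-shifted (suc m) n = trans (∑-upTo-suc m _) (cong₂ _+_ (∑-zero (upTo n) (λ _ _ → refl)) (∑∑-equal m n))

horizontal-column : ∀ i h → Horizontal.adjacencies (column i h) (column i h) ≡ pred h
horizontal-column i h = begin
  Horizontal.adjacencies (column i h) (column i h)
    ≡⟨ trans (∑-map _ (upTo h) _) (∑-cong (upTo h) (λ r _ → ∑-map _ (upTo h) _)) ⟩
  (∑[ r ∈ upTo h ] ∑[ s ∈ upTo h ] ⟦ (i , suc (i + r)) ≟ᶜ (i , i + s) ⟧)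
    ≡⟨ ∑-swap (upTo h) (upTo h) (λ r s → ⟦ (i , suc (i + r)) ≟ᶜ (i , i + s) ⟧) ⟩
  (∑[ s ∈ upTo h ] ∑[ r ∈ upTo h ] ⟦ (i , suc (i + r)) ≟ᶜ (i , i + s) ⟧)
    ≡⟨ ∑-cong (upTo h) (λ s _ → ∑-cong (upTo h) (λ r _ → ⟦⟧-cong ((i , suc (i + r)) ≟ᶜ (i , i + s)) (s ≟ suc r)
         (λ eq → ℕₚ.+-cancelˡ-≡ i s (suc r) (trans (sym (,-injectiveʳ eq)) (sym (ℕₚ.+-suc i r))))
         (λ { refl → cong (i ,_) (sym (ℕₚ.+-suc i r)) }))) ⟩
  (∑[ s ∈ upTo h ] ∑[ r ∈ upTo h ] ⟦ s ≟ suc r ⟧)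
    ≡⟨ ∑∑-shifted h h ⟩
  pred h ⊓ h
    ≡⟨ ℕₚ.m≤n⇒m⊓n≡m (ℕₚ.pred[n]≤n {h}) ⟩
  pred h ∎
  where open ≡-Reasoning

-- Column `suc i` starts one row higher, so its cell `s` lies beside cell `suc s` of column `i`,
-- whose bottom cell has no right neighbour.
vertical-columns : ∀ i h h′ → Vertical.adjacencies (column i h) (column (suc i) h′) ≡ pred h ⊓ h′
vertical-columns i h h′ = begin
  Vertical.adjacencies (column i h) (column (suc i) h′)
    ≡⟨ trans (∑-map _ (upTo h) _) (∑-cong (upTo h) (λ r _ → ∑-map _ (upTo h′) _)) ⟩
  (∑[ r ∈ upTo h ] ∑[ s ∈ upTo h′ ] ⟦ (suc i , i + r) ≟ᶜ (suc i , suc i + s) ⟧)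
    ≡⟨ ∑-cong (upTo h) (λ r _ → ∑-cong (upTo h′) (λ s _ → ⟦⟧-cong ((suc i , i + r) ≟ᶜ (suc i , suc i + s)) (r ≟ suc s)
         (λ eq → ℕₚ.+-cancelˡ-≡ i r (suc s) (trans (,-injectiveʳ eq) (sym (ℕₚ.+-suc i s))))
         (λ { refl → cong (suc i ,_) (ℕₚ.+-suc i s) }))) ⟩
  (∑[ r ∈ upTo h ] ∑[ s ∈ upTo h′ ] ⟦ r ≟ suc s ⟧)
    ≡⟨ ∑∑-shifted h h′ ⟩
  pred h ⊓ h′ ∎
  where open ≡-Reasoning

horizontal-cellsFrom : ∀ i hs → Horizontal.adjacencies (cellsFrom i hs) (cellsFrom i hs) ≡ sum (map pred hs)
horizontal-cellsFrom i []       = refl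
horizontal-cellsFrom i (h ∷ hs) = begin
  Horizontal.adjacencies (col ++ rest) (col ++ rest)
    ≡⟨ Horizontal.adjacencies-++ col rest ⟩
  _ ≡⟨ cong₂ _+_ (cong₂ _+_ (horizontal-column i h) (Horizontal.adjacencies-disjoint col rest col↛rest))
         (cong₂ _+_ (Horizontal.adjacencies-disjoint rest col rest↛col) (horizontal-cellsFrom (suc i) hs)) ⟩
  (pred h + 0) + sum (map pred hs)
    ≡⟨ cong (_+ sum (map pred hs)) (ℕₚ.+-identityʳ (pred h)) ⟩
  pred h + sum (map pred hs) ∎
  where
  open ≡-Reasoning
  col = column i h
  rest = cellsFrom (suc i) hs
  col↛rest : ∀ {c d} → c ∈ col → d ∈ rest → above c ≢ d
  col↛rest c∈ d∈ refl = ℕₚ.<-irrefl (sym (∈-column {h = h} c∈)) (∈-cellsFrom hs d∈)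
  rest↛col : ∀ {c d} → c ∈ rest → d ∈ col → above c ≢ d
  rest↛col c∈ d∈ refl = ℕₚ.<-irrefl (sym (∈-column {h = h} d∈)) (∈-cellsFrom hs c∈)

-- The number of vertical unit edges shared by neighbouring columns.
contacts : List ℕ → ℕ
contacts []             = 0
contacts (h ∷ [])       = 0
contacts (h ∷ h′ ∷ hs)  = pred h ⊓ h′ + contacts (h′ ∷ hs)

-- A step to the right raises the column index by one, so besides the recursive block only the one
-- from `col` to `rest` survives.
vertical-cellsFrom : ∀ i hs → Vertical.adjacencies (cellsFrom i hs) (cellsFrom i hs) ≡ contacts hs
vertical-cellsFrom i []       = refl
vertical-cellsFrom i (h ∷ hs) = begin
  Vertical.adjacencies (col ++ rest) (col ++ rest)
    ≡⟨ Vertical.adjacencies-++ col rest ⟩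
  _ ≡⟨ cong₂ _+_ (cong (_+ Vertical.adjacencies col rest) (Vertical.adjacencies-disjoint col col col↛col))
         (cong₂ _+_ (Vertical.adjacencies-disjoint rest col rest↛col) (vertical-cellsFrom (suc i) hs)) ⟩
  Vertical.adjacencies col rest + contacts hs
    ≡⟨ contact hs ⟩
  contacts (h ∷ hs) ∎
  where
  open ≡-Reasoning
  col = column i h
  rest = cellsFrom (suc i) hs
  col↛col : ∀ {c d} → c ∈ col → d ∈ col → right c ≢ d
  col↛col c∈ d∈ refl = ℕₚ.1+n≢n (trans (∈-column {h = h} d∈) (sym (∈-column {h = h} c∈)))
  rest↛col : ∀ {c d} → c ∈ rest → d ∈ col → right c ≢ d
  rest↛col c∈ d∈ refl = ℕₚ.<-irrefl (sym (∈-column {h = h} d∈)) (ℕₚ.m≤n⇒m≤1+n (∈-cellsFrom hs c∈))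
  contact : ∀ hs → Vertical.adjacencies col (cellsFrom (suc i) hs) + contacts hs ≡ contacts (h ∷ hs)
  contact []        = cong (_+ 0) (Vertical.adjacencies-disjoint col [] (λ _ ()))
  contact (h′ ∷ hs) = cong (_+ contacts (h′ ∷ hs)) (begin
    Vertical.adjacencies col (column (suc i) h′ ++ cellsFrom (2 + i) hs)
      ≡⟨ trans (∑-cong col (λ c _ → ∑-++ (column (suc i) h′) _ _)) (∑-+ col _ _) ⟩
    Vertical.adjacencies col (column (suc i) h′) + Vertical.adjacencies col (cellsFrom (2 + i) hs)
      ≡⟨ cong₂ _+_ (vertical-columns i h h′) (Vertical.adjacencies-disjoint col (cellsFrom (2 + i) hs) far) ⟩
    pred h ⊓ h′ + 0
      ≡⟨ ℕₚ.+-identityʳ _ ⟩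
    pred h ⊓ h′ ∎)
    where
    far : ∀ {c d} → c ∈ col → d ∈ cellsFrom (2 + i) hs → right c ≢ d
    far c∈ d∈ refl = ℕₚ.<-irrefl (cong suc (sym (∈-column {h = h} c∈))) (∈-cellsFrom hs d∈)

-- Semiperimeters in terms of the heights.

FibonacciHeights⇒positive : ∀ {hs} → FibonacciHeights hs → All (1 ≤_) hs
FibonacciHeights⇒positive (last p)     = p ∷ []
FibonacciHeights⇒positive (next 2≤h f) = ℕₚ.<⇒≤ 2≤h ∷ FibonacciHeights⇒positive f

length+sum-pred : ∀ {hs} → All (1 ≤_) hs → length hs + sum (map pred hs) ≡ sum hs
length+sum-pred []                           = refl
length+sum-pred {suc h ∷ hs} (s≤s z≤n ∷ pos) =
  cong suc (trans (swap (length hs) h _) (cong (h +_) (length+sum-pred pos)))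
  where
  swap : ∀ a b c → a + (b + c) ≡ b + (a + c)
  swap = solve-∀

-- A column of height h has h - 1 internal horizontal edges, which leaves its bottom and its top on
-- the boundary.
horizontal-semiperimeter : ∀ {hs} → All (1 ≤_) hs →
  length (boundary horizontalSides (cells hs)) ≡ 2 * length hs
horizontal-semiperimeter {hs} pos = ℕₚ.+-cancelʳ-≡ (2 * q) _ _ (begin
  length (boundary horizontalSides (cells hs)) + 2 * q
    ≡⟨ cong (λ s → length (boundary horizontalSides (cells hs)) + 2 * s) (sym (horizontal-cellsFrom 1 hs)) ⟩
  _ ≡⟨ Horizontal.length-boundary (cellsFrom-unique 1 hs) ⟩
  2 * length (cells hs)
    ≡⟨ cong (2 *_) (trans (length-cellsFrom 1 hs) (sym (length+sum-pred pos))) ⟩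
  2 * (length hs + q)
    ≡⟨ ℕₚ.*-distribˡ-+ 2 (length hs) q ⟩
  2 * length hs + 2 * q ∎)
  where
  open ≡-Reasoning
  q = sum (map pred hs)

-- The number of left sides on the boundary of the columns hs, when they follow
-- a column with L cells above its bottom one.
leftSides : ℕ → List ℕ → ℕ
leftSides L []       = 0
leftSides L (h ∷ hs) = (h ∸ L) + leftSides (pred h) hs

-- Each cell after the first column either touches the preceding column or shows its left side on
-- the boundary.
leftSides+contacts : ∀ h hs → leftSides (pred h) hs + contacts (h ∷ hs) ≡ sum hs
leftSides+contacts h []        = refl
leftSides+contacts h (h′ ∷ hs) = begin
  (h′ ∸ pred h) + leftSides (pred h′) hs + (pred h ⊓ h′ + contacts (h′ ∷ hs))
    ≡⟨ interchange (h′ ∸ pred h) _ (pred h ⊓ h′) _ ⟩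
  (pred h ⊓ h′ + (h′ ∸ pred h)) + (leftSides (pred h′) hs + contacts (h′ ∷ hs))
    ≡⟨ cong₂ _+_ (ℕₚ.m⊓n+n∸m≡n (pred h) h′) (leftSides+contacts h′ hs) ⟩
  h′ + sum hs ∎
  where
  open ≡-Reasoning
  interchange : ∀ a b c d → a + b + (c + d) ≡ (c + a) + (b + d)
  interchange = solve-∀

-- Taking the contacts away from all cells leaves the left sides; the start level 0 makes every cell
-- of the first column count.
vertical-semiperimeter : ∀ hs → length (boundary verticalSides (cells hs)) ≡ 2 * leftSides 0 hs
vertical-semiperimeter []          = refl
vertical-semiperimeter hs@(h ∷ hs′) = ℕₚ.+-cancelʳ-≡ (2 * contacts hs) _ _ (begin
  length (boundary verticalSides (cells hs)) + 2 * contacts hs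
    ≡⟨ cong (λ s → length (boundary verticalSides (cells hs)) + 2 * s) (sym (vertical-cellsFrom 1 hs)) ⟩
  _ ≡⟨ Vertical.length-boundary (cellsFrom-unique 1 hs) ⟩
  2 * length (cells hs)
    ≡⟨ cong (2 *_) (trans (length-cellsFrom 1 hs) (cong (h +_) (sym (leftSides+contacts h hs′)))) ⟩
  2 * (h + (leftSides (pred h) hs′ + contacts hs))
    ≡⟨ regroup h _ (contacts hs) ⟩
  2 * (h + leftSides (pred h) hs′) + 2 * contacts hs ∎)
  where
  open ≡-Reasoning
  regroup : ∀ a b c → 2 * (a + (b + c)) ≡ 2 * (a + b) + 2 * c
  regroup = solve-∀

-- Relaxed profiles

-- This is `leftSides` for columns of heights `suc k`, expressed through their levels.
ascent : ℕ → List ℕ → ℕ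
ascent L []       = 0
ascent L (k ∷ ks) = (suc k ∸ L) + ascent k ks

-- Profile m L n codes the lists of m levels whose ascent from L is n.  In
-- Descent m L n and Rise m L n there are suc m levels, the first of which is
-- below L or not.  Climb m L n is coded by steps upwards from L, each of
-- weight 1, to the first level.
mutual
  Profile Descent Rise Climb : ℕ → ℕ → ℕ → Set
  Profile zero    L zero    = ⊤
  Profile zero    L (suc n) = ⊥
  Profile (suc m) L n       = Descent m L n ⊎ Rise m L n
  Descent m zero    n = ⊥
  Descent m (suc L) n = Descent m L n ⊎ Profile m L n
  Rise m L zero    = ⊥
  Rise m L (suc n) = Climb m L n
  Climb m L zero    = Profile m L zero
  Climb m L (suc n) = Profile m L (suc n) ⊎ Climb m (suc L) n

mutual
  -- The recursion of the code types with sums for disjoint unions, so that the bijections with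
  -- `Fin` follow clause by clause.
  profiles descents rises climbs : ℕ → ℕ → ℕ → ℕ
  profiles zero    L zero    = 1
  profiles zero    L (suc n) = 0
  profiles (suc m) L n       = descents m L n + rises m L n
  descents m zero    n = 0
  descents m (suc L) n = descents m L n + profiles m L n
  rises m L zero    = 0
  rises m L (suc n) = climbs m L n
  climbs m L zero    = profiles m L zero
  climbs m L (suc n) = profiles m L (suc n) + climbs m (suc L) n

+↔⊎-cong : ∀ {a b} {A B : Set} → Fin a ↔ A → Fin b ↔ B → Fin (a + b) ↔ (A ⊎ B)
+↔⊎-cong p q = (p ⊎-↔ q) ↔-∘ +↔⊎

mutual
  profiles↔ : ∀ m L n → Fin (profiles m L n) ↔ Profile m L n
  profiles↔ zero    L zero    = 1↔⊤
  profiles↔ zero    L (suc n) = 0↔⊥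
  profiles↔ (suc m) L n       = +↔⊎-cong (descents↔ m L n) (rises↔ m L n)

  descents↔ : ∀ m L n → Fin (descents m L n) ↔ Descent m L n
  descents↔ m zero    n = 0↔⊥
  descents↔ m (suc L) n = +↔⊎-cong (descents↔ m L n) (profiles↔ m L n)

  rises↔ : ∀ m L n → Fin (rises m L n) ↔ Rise m L n
  rises↔ m L zero    = 0↔⊥
  rises↔ m L (suc n) = climbs↔ m L n

  climbs↔ : ∀ m L n → Fin (climbs m L n) ↔ Climb m L n
  climbs↔ m L zero    = profiles↔ m L zero
  climbs↔ m L (suc n) = +↔⊎-cong (profiles↔ m L (suc n)) (climbs↔ m (suc L) n)

-- Decoding of profiles and its bijectivity.

mutual
  levels : ∀ m L n → Profile m L n → List ℕ
  levels zero    L zero    _        = []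
  levels (suc m) L n       (inj₁ d) = levelsᵈ m L n d
  levels (suc m) L (suc n) (inj₂ c) = levelsᶜ m L n c

  levelsᵈ : ∀ m L n → Descent m L n → List ℕ
  levelsᵈ m (suc L) n (inj₁ d) = levelsᵈ m L n d
  levelsᵈ m (suc L) n (inj₂ p) = L ∷ levels m L n p

  levelsᶜ : ∀ m L n → Climb m L n → List ℕ
  levelsᶜ m L zero    p        = L ∷ levels m L zero p
  levelsᶜ m L (suc n) (inj₁ p) = L ∷ levels m L (suc n) p
  levelsᶜ m L (suc n) (inj₂ c) = levelsᶜ m (suc L) n c

mutual
  length-levels : ∀ m L n p → length (levels m L n p) ≡ m
  length-levels zero    L zero    _        = refl
  length-levels (suc m) L n       (inj₁ d) = length-levelsᵈ m L n d
  length-levels (suc m) L (suc n) (inj₂ c) = length-levelsᶜ m L n c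

  length-levelsᵈ : ∀ m L n d → length (levelsᵈ m L n d) ≡ suc m
  length-levelsᵈ m (suc L) n (inj₁ d) = length-levelsᵈ m L n d
  length-levelsᵈ m (suc L) n (inj₂ p) = cong suc (length-levels m L n p)

  length-levelsᶜ : ∀ m L n c → length (levelsᶜ m L n c) ≡ suc m
  length-levelsᶜ m L zero    p        = cong suc (length-levels m L zero p)
  length-levelsᶜ m L (suc n) (inj₁ p) = cong suc (length-levels m L (suc n) p)
  length-levelsᶜ m L (suc n) (inj₂ c) = length-levelsᶜ m (suc L) n c

mutual
  ascent-levels : ∀ m L n p → ascent L (levels m L n p) ≡ n
  ascent-levels zero    L zero    _        = refl
  ascent-levels (suc m) L n       (inj₁ d) = ascent-levelsᵈ m L n d ℕₚ.≤-refl
  ascent-levels (suc m) L (suc n) (inj₂ c) =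
    trans (ascent-levelsᶜ m L n c ℕₚ.≤-refl) (cong (λ s → suc s + n) (ℕₚ.n∸n≡0 L))

  -- The reference level `L₀` stays fixed while the code descends; the first level ends up below it
  -- and contributes 0.
  ascent-levelsᵈ : ∀ m L n d {L₀} → L ≤ L₀ → ascent L₀ (levelsᵈ m L n d) ≡ n
  ascent-levelsᵈ m (suc L) n (inj₁ d) L<L₀ = ascent-levelsᵈ m L n d (ℕₚ.<⇒≤ L<L₀)
  ascent-levelsᵈ m (suc L) n (inj₂ p) L<L₀ = cong₂ _+_ (ℕₚ.m≤n⇒m∸n≡0 L<L₀) (ascent-levels m L n p)

  -- `suc (L ∸ L₀)` is the weight already spent, one for rising at all and one for each step climbed
  -- from `L₀`; `n` is the weight that remains.
  ascent-levelsᶜ : ∀ m L n c {L₀} → L₀ ≤ L → ascent L₀ (levelsᶜ m L n c) ≡ suc (L ∸ L₀) + n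
  ascent-levelsᶜ m L zero    p        L₀≤L = cong₂ _+_ (ℕₚ.+-∸-assoc 1 L₀≤L) (ascent-levels m L zero p)
  ascent-levelsᶜ m L (suc n) (inj₁ p) L₀≤L = cong₂ _+_ (ℕₚ.+-∸-assoc 1 L₀≤L) (ascent-levels m L (suc n) p)
  ascent-levelsᶜ m L (suc n) (inj₂ c) {L₀} L₀≤L = begin
    ascent L₀ (levelsᶜ m (suc L) n c)  ≡⟨ ascent-levelsᶜ m (suc L) n c (ℕₚ.m≤n⇒m≤1+n L₀≤L) ⟩
    suc (suc L ∸ L₀) + n               ≡⟨ cong (λ s → suc s + n) (ℕₚ.+-∸-assoc 1 L₀≤L) ⟩
    suc (suc (L ∸ L₀)) + n             ≡⟨ sym (ℕₚ.+-suc (suc (L ∸ L₀)) n) ⟩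
    suc (L ∸ L₀) + suc n               ∎
    where open ≡-Reasoning

1+[m+n]∸m≡1+n : ∀ m n → suc (m + n) ∸ m ≡ suc n
1+[m+n]∸m≡1+n m n = trans (ℕₚ.+-∸-assoc 1 (ℕₚ.m≤m+n m n)) (cong suc (ℕₚ.m+n∸m≡n m n))

mutual
  levels-surjective : ∀ L ks n → ascent L ks ≡ n → ∃[ p ] levels (length ks) L n p ≡ ks
  levels-surjective L []       zero eq = tt , refl
  levels-surjective L (k ∷ ks) n eq with k <? L
  ... | yes k<L =
    let d , e = levelsᵈ-surjective L ks n k<L (trans (cong (_+ ascent k ks) (sym (ℕₚ.m≤n⇒m∸n≡0 k<L))) eq)
    in inj₁ d , e
  -- Writing k = L + j makes j the number of climbing steps.
  ... | no k≮L with ℕₚ.m≤n⇒∃[o]m+o≡n (ℕₚ.≮⇒≥ k≮L)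
  ...   | j , refl with n
  -- A first level not below `L` costs at least 1, which excludes weight 0.
  ...     | zero = contradiction (ℕₚ.m+n≡0⇒m≡0 (suc (L + j) ∸ L) eq) (λ e → ℕₚ.1+n≢0 (trans (sym (1+[m+n]∸m≡1+n L j)) e))
  ...     | suc n =
    let c , e = levelsᶜ-surjective L ks n j (ℕₚ.suc-injective (trans (cong (_+ ascent (L + j) ks) (sym (1+[m+n]∸m≡1+n L j))) eq))
    in inj₂ c , e

  levelsᵈ-surjective : ∀ L ks n {k} → k < L → ascent k ks ≡ n → ∃[ d ] levelsᵈ (length ks) L n d ≡ k ∷ ks
  levelsᵈ-surjective (suc L) ks n {k} k<L eq with ℕₚ.m<1+n⇒m<n∨m≡n k<L
  ... | inj₁ k<L′ = let d , e = levelsᵈ-surjective L ks n k<L′ eq in inj₁ d , e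
  ... | inj₂ refl = let p , e = levels-surjective k ks n eq in inj₂ p , cong (k ∷_) e

  levelsᶜ-surjective : ∀ L ks n j → j + ascent (L + j) ks ≡ n → ∃[ c ] levelsᶜ (length ks) L n c ≡ (L + j) ∷ ks
  -- `Climb` reduces only once its weight is in constructor form; the split on `n` selects the
  -- clause, and both cases stop at `L`.
  levelsᶜ-surjective L ks n zero eq rewrite ℕₚ.+-identityʳ L with n | levels-surjective L ks n eq
  ... | zero  | p , e = p , cong (L ∷_) e
  ... | suc n | p , e = inj₁ p , cong (L ∷_) e
  levelsᶜ-surjective L ks (suc n) (suc j) eq rewrite ℕₚ.+-suc L j =
    let c , e = levelsᶜ-surjective (suc L) ks n j (ℕₚ.suc-injective eq) in inj₂ c , e

-- Together with `levelsᶜ-head` this makes decoding injective: the two sides of each disjoint union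
-- in the codes lead to different first levels.
levelsᵈ-head : ∀ m L n d {k ks} → levelsᵈ m L n d ≡ k ∷ ks → k < L
levelsᵈ-head m (suc L) n (inj₁ d) eq   = ℕₚ.m≤n⇒m≤1+n (levelsᵈ-head m L n d eq)
levelsᵈ-head m (suc L) n (inj₂ p) refl = ℕₚ.≤-refl

levelsᶜ-head : ∀ m L n c {k ks} → levelsᶜ m L n c ≡ k ∷ ks → L ≤ k
levelsᶜ-head m L zero    p        refl = ℕₚ.≤-refl
levelsᶜ-head m L (suc n) (inj₁ p) refl = ℕₚ.≤-refl
levelsᶜ-head m L (suc n) (inj₂ c) eq   = ℕₚ.<⇒≤ (levelsᶜ-head m (suc L) n c eq)

levelsᵈ≢levelsᶜ : ∀ m L n n′ d c → levelsᵈ m L n d ≢ levelsᶜ m L n′ c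
levelsᵈ≢levelsᶜ m L n n′ d c eq with levelsᶜ m L n′ c in eqᶜ
... | []     = ℕₚ.1+n≢0 (trans (sym (length-levelsᶜ m L n′ c)) (cong length eqᶜ))
... | k ∷ ks = ℕₚ.<⇒≱ (levelsᵈ-head m L n d eq) (levelsᶜ-head m L n′ c eqᶜ)

mutual
  levels-injective : ∀ m L n p q → levels m L n p ≡ levels m L n q → p ≡ q
  levels-injective zero    L zero    _        _        eq = refl
  levels-injective (suc m) L n       (inj₁ d) (inj₁ e) eq = cong inj₁ (levelsᵈ-injective m L n d e eq)
  levels-injective (suc m) L (suc n) (inj₂ c) (inj₂ e) eq = cong inj₂ (levelsᶜ-injective m L n c e eq)
  levels-injective (suc m) L (suc n) (inj₁ d) (inj₂ c) eq = contradiction eq (levelsᵈ≢levelsᶜ m L (suc n) n d c)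
  levels-injective (suc m) L (suc n) (inj₂ c) (inj₁ d) eq = contradiction (sym eq) (levelsᵈ≢levelsᶜ m L (suc n) n d c)

  levelsᵈ-injective : ∀ m L n d e → levelsᵈ m L n d ≡ levelsᵈ m L n e → d ≡ e
  levelsᵈ-injective m (suc L) n (inj₁ d) (inj₁ e) eq = cong inj₁ (levelsᵈ-injective m L n d e eq)
  levelsᵈ-injective m (suc L) n (inj₁ d) (inj₂ p) eq = contradiction (levelsᵈ-head m L n d eq) (ℕₚ.<-irrefl refl)
  levelsᵈ-injective m (suc L) n (inj₂ p) (inj₁ d) eq = contradiction (levelsᵈ-head m L n d (sym eq)) (ℕₚ.<-irrefl refl)
  levelsᵈ-injective m (suc L) n (inj₂ p) (inj₂ q) eq = cong inj₂ (levels-injective m L n p q (∷-injectiveʳ eq))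

  levelsᶜ-injective : ∀ m L n c e → levelsᶜ m L n c ≡ levelsᶜ m L n e → c ≡ e
  levelsᶜ-injective m L zero    p        q        eq = levels-injective m L zero p q (∷-injectiveʳ eq)
  levelsᶜ-injective m L (suc n) (inj₁ p) (inj₁ q) eq = cong inj₁ (levels-injective m L (suc n) p q (∷-injectiveʳ eq))
  levelsᶜ-injective m L (suc n) (inj₁ p) (inj₂ c) eq = contradiction (levelsᶜ-head m (suc L) n c (sym eq)) (ℕₚ.<-irrefl refl)
  levelsᶜ-injective m L (suc n) (inj₂ c) (inj₁ p) eq = contradiction (levelsᶜ-head m (suc L) n c eq) (ℕₚ.<-irrefl refl)
  levelsᶜ-injective m L (suc n) (inj₂ c) (inj₂ e) eq = cong inj₂ (levelsᶜ-injective m (suc L) n c e eq)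

-- Polyominoes as profiles

open FibonacciPolyomino

FibonacciHeights-irrelevant : ∀ {hs} (f g : FibonacciHeights hs) → f ≡ g
FibonacciHeights-irrelevant (last p)   (last q)   = cong last (ℕₚ.≤-irrelevant p q)
FibonacciHeights-irrelevant (next p f) (next q g) =
  cong₂ next (ℕₚ.≤-irrelevant p q) (FibonacciHeights-irrelevant f g)

-- The other fields are propositions with at most one proof, so the heights are the only data.
heights-injective : ∀ {m n} {P Q : FibonacciPolyomino m n} → heights P ≡ heights Q → P ≡ Q
heights-injective
  {P = record { fibonacci = f ; horizontalSemi = h ; verticalSemi = v }}
  {Q = record { fibonacci = g ; horizontalSemi = h′ ; verticalSemi = v′ }} refl
  with refl ← FibonacciHeights-irrelevant f g
     | refl ← ℕₚ.≡-irrelevant h h′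
     | refl ← ℕₚ.≡-irrelevant v v′ = refl

-- The flag records whether there is a last column of height 1 after the columns
-- of height at least 2.
toHeights : Bool → List ℕ → List ℕ
toHeights b     (k ∷ ks) = 2 + k ∷ toHeights b ks
toHeights false []       = []
toHeights true  []       = 1 ∷ []

lastColumn : Bool → ℕ
lastColumn false = 0
lastColumn true  = 1

length-toHeights : ∀ b ks → length (toHeights b ks) ≡ lastColumn b + length ks
length-toHeights false []       = refl
length-toHeights true  []       = refl
length-toHeights b     (k ∷ ks) = trans (cong suc (length-toHeights b ks)) (sym (ℕₚ.+-suc (lastColumn b) _))

toHeights-fibonacci : ∀ b ks → toHeights b ks ≢ [] → FibonacciHeights (toHeights b ks)
toHeights-fibonacci false []                ne = contradiction refl ne
toHeights-fibonacci true  []                ne = last ℕₚ.≤-refl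
toHeights-fibonacci false (k ∷ [])          ne = last (s≤s z≤n)
toHeights-fibonacci true  (k ∷ [])          ne = next (s≤s (s≤s z≤n)) (last ℕₚ.≤-refl)
toHeights-fibonacci b     (k ∷ ks@(_ ∷ _))  ne = next (s≤s (s≤s z≤n)) (toHeights-fibonacci b ks λ ())

toHeights-surjective : ∀ {hs} → FibonacciHeights hs → ∃[ b ] ∃[ ks ] toHeights b ks ≡ hs
toHeights-surjective (last {suc zero}    _)         = true , [] , refl
toHeights-surjective (last {suc (suc k)} _)         = false , k ∷ [] , refl
toHeights-surjective (next {suc (suc k)} _ f)       =
  let b , ks , eq = toHeights-surjective f in b , k ∷ ks , cong (2 + k ∷_) eq
toHeights-surjective (next {suc zero} (s≤s ()) f)

toHeights-injective : ∀ b b′ ks ks′ → toHeights b ks ≡ toHeights b′ ks′ → b ≡ b′ × ks ≡ ks′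
toHeights-injective false false []       []         eq = refl , refl
toHeights-injective true  true  []       []         eq = refl , refl
toHeights-injective false true  []       []         ()
toHeights-injective false true  (_ ∷ _)  []         ()
toHeights-injective true  false []       []         ()
toHeights-injective true  false (_ ∷ _)  []         ()
toHeights-injective b     b′    (k ∷ ks) (k′ ∷ ks′) eq
  with refl ← ∷-injectiveˡ eq
     | refl , refl ← toHeights-injective b b′ ks ks′ (∷-injectiveʳ eq) = refl , refl

-- Lowering a column together with its predecessor keeps the difference, `2 + k ∸ suc L` being
-- `suc k ∸ L`; a last column of height 1 gives `1 ∸ suc L`, which is 0.
leftSides-toHeights : ∀ L b ks → leftSides (suc L) (toHeights b ks) ≡ ascent L ks
leftSides-toHeights L false []       = refl
leftSides-toHeights L true  []       = trans (ℕₚ.+-identityʳ (0 ∸ L)) (ℕₚ.0∸n≡0 L)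
leftSides-toHeights L b     (k ∷ ks) = cong ((suc k ∸ L) +_) (leftSides-toHeights k b ks)

-- The first column has no predecessor to be lowered with it, which costs one extra left side: the
-- factor y in y (R_m + R_{m-1}).
leftSides-toHeights₀ : ∀ b ks → toHeights b ks ≢ [] → leftSides 0 (toHeights b ks) ≡ suc (ascent 0 ks)
leftSides-toHeights₀ false []       ne = contradiction refl ne
leftSides-toHeights₀ true  []       ne = refl
leftSides-toHeights₀ b     (k ∷ ks) ne = cong (2 + k +_) (leftSides-toHeights k b ks)

nonempty : ∀ {m} {ks : List ℕ} → length ks ≡ suc m → ks ≢ []
nonempty () refl

-- The bijection between polyominoes and profiles.

module _ {m n : ℕ} where

  polyomino : ∀ b ks → lastColumn b + length ks ≡ suc m → ascent 0 ks ≡ n → FibonacciPolyomino (suc m) (suc n)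
  polyomino b ks len asc = record
    { heights        = toHeights b ks
    ; fibonacci      = fib
    ; horizontalSemi = trans (horizontal-semiperimeter (FibonacciHeights⇒positive fib)) (cong (2 *_) len′)
    ; verticalSemi   = trans (vertical-semiperimeter (toHeights b ks))
                         (cong (2 *_) (trans (leftSides-toHeights₀ b ks ne) (cong suc asc)))
    }
    where
    len′ = trans (length-toHeights b ks) len
    ne   = nonempty len′
    fib  = toHeights-fibonacci b ks ne

  fromProfiles : Profile (suc m) 0 n ⊎ Profile m 0 n → FibonacciPolyomino (suc m) (suc n)
  fromProfiles (inj₁ p) = polyomino false (levels (suc m) 0 n p) (length-levels (suc m) 0 n p) (ascent-levels (suc m) 0 n p)
  fromProfiles (inj₂ p) = polyomino true (levels m 0 n p) (cong suc (length-levels m 0 n p)) (ascent-levels m 0 n p)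

  fromProfiles-injective : ∀ p q → heights (fromProfiles p) ≡ heights (fromProfiles q) → p ≡ q
  fromProfiles-injective (inj₁ p) (inj₁ q) eq =
    cong inj₁ (levels-injective (suc m) 0 n p q (proj₂ (toHeights-injective false false _ _ eq)))
  fromProfiles-injective (inj₂ p) (inj₂ q) eq =
    cong inj₂ (levels-injective m 0 n p q (proj₂ (toHeights-injective true true _ _ eq)))
  fromProfiles-injective (inj₁ p) (inj₂ q) eq = contradiction (proj₁ (toHeights-injective false true _ _ eq)) λ ()
  fromProfiles-injective (inj₂ p) (inj₁ q) eq = contradiction (proj₁ (toHeights-injective true false _ _ eq)) λ ()

  fromProfiles-surjective : ∀ P → ∃[ p ] fromProfiles p ≡ P
  fromProfiles-surjective P = preimage (toHeights-surjective (fibonacci P))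
    where
    len : length (heights P) ≡ suc m
    len = ℕₚ.*-cancelˡ-≡ _ _ 2
      (trans (sym (horizontal-semiperimeter (FibonacciHeights⇒positive (fibonacci P)))) (horizontalSemi P))
    asc : leftSides 0 (heights P) ≡ suc n
    asc = ℕₚ.*-cancelˡ-≡ _ _ 2 (trans (sym (vertical-semiperimeter (heights P))) (verticalSemi P))
    -- With the number of levels as a variable, it can be identified with `length ks`, the index at
    -- which surjectivity is stated.
    levels-onto : ∀ m′ ks → length ks ≡ m′ → ascent 0 ks ≡ n → ∃[ p ] levels m′ 0 n p ≡ ks
    levels-onto _ ks refl = levels-surjective 0 ks n
    preimage : (∃[ b ] ∃[ ks ] toHeights b ks ≡ heights P) → ∃[ p ] fromProfiles p ≡ P
    preimage (b , ks , eq) = go b eq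
      (trans (sym (length-toHeights b ks)) len′)
      (ℕₚ.suc-injective (trans (sym (leftSides-toHeights₀ b ks (nonempty len′))) (trans (cong (leftSides 0) eq) asc)))
      where
      len′ : length (toHeights b ks) ≡ suc m
      len′ = trans (cong length eq) len
      go : ∀ b → toHeights b ks ≡ heights P → lastColumn b + length ks ≡ suc m → ascent 0 ks ≡ n →
        ∃[ p ] fromProfiles p ≡ P
      go false eq l a = let p , e = levels-onto (suc m) ks l a
        in inj₁ p , heights-injective (trans (cong (toHeights false) e) eq)
      go true eq l a = let p , e = levels-onto m ks (ℕₚ.suc-injective l) a
        in inj₂ p , heights-injective (trans (cong (toHeights true) e) eq)

  polyominoes↔ : Fin (profiles (suc m) 0 n + profiles m 0 n) ↔ FibonacciPolyomino (suc m) (suc n)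
  polyominoes↔ = mk↔ₛ′ fromProfiles (proj₁ ∘ fromProfiles-surjective) (proj₂ ∘ fromProfiles-surjective)
      (λ p → fromProfiles-injective _ p (cong heights (proj₂ (fromProfiles-surjective (fromProfiles p)))))
    ↔-∘ +↔⊎-cong (profiles↔ (suc m) 0 n) (profiles↔ m 0 n)

count : ℕ → ℕ → ℕ
count (suc m) (suc n) = profiles (suc m) 0 n + profiles m 0 n
count _       _       = 0

count-correct : CountsFibonacciPolyominoes count
count-correct (suc m) (suc n) _ _ = polyominoes↔

-- Ballot numbers and the transfer operator

-- Counts the lattice paths with `m + j` up steps and `m` down steps that never go below their
-- start; the recursion removes the last step.
ballot : ℕ → ℕ → ℕ
ballot zero    j       = 1
ballot (suc m) zero    = ballot m 1
ballot (suc m) (suc j) = ballot m (suc (suc j)) + ballot (suc m) j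

-- n choose k - 1, which is 0 for k = 0.
_C⁻_ : ℕ → ℕ → ℕ
n C⁻ zero  = 0
n C⁻ suc k = n C k

C⁻-pascal : ∀ n k → n C⁻ k + n C k ≡ suc n C k
C⁻-pascal n zero    = refl
C⁻-pascal n (suc k) = nCk+nC[k+1]≡[n+1]C[k+1] n k

-- This is the reflection formula at j = -1, where the ballot number vanishes; it starts the
-- induction on j.
central-symmetric : ∀ m → suc (2 * m) C m ≡ suc (2 * m) C suc m
central-symmetric m = trans (nCk≡nC[n∸k] m≤) (cong (suc (2 * m) C_) complement)
  where
  double : ∀ m → suc (2 * m) ≡ m + suc m
  double = solve-∀
  m≤ : m ≤ suc (2 * m)
  m≤ = subst (m ≤_) (sym (double m)) (ℕₚ.m≤m+n m (suc m))
  complement : suc (2 * m) ∸ m ≡ suc m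
  complement = trans (cong (_∸ m) (double m)) (ℕₚ.m+n∸m≡n m (suc m))

-- The reflection principle, ballot m j = (2m+j choose m) - (2m+j choose m-1).
ballot-reflection : ∀ m j → ballot m j + (2 * m + j) C⁻ m ≡ (2 * m + j) C m
ballot-reflection zero j = refl
ballot-reflection (suc m) zero = begin
  ballot m 1 + (2 * suc m + 0) C m
    ≡⟨ cong (λ s → ballot m 1 + s C m) (even m) ⟩
  ballot m 1 + suc N C m
    ≡⟨ cong (ballot m 1 +_) (sym (C⁻-pascal N m)) ⟩
  ballot m 1 + (N C⁻ m + N C m)
    ≡⟨ sym (ℕₚ.+-assoc (ballot m 1) _ _) ⟩
  ballot m 1 + N C⁻ m + N C m
    ≡⟨ cong (_+ N C m) reflected ⟩
  N C m + N C m
    ≡⟨ cong (N C m +_) (central-symmetric m) ⟩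
  N C m + N C suc m
    ≡⟨ nCk+nC[k+1]≡[n+1]C[k+1] N m ⟩
  suc N C suc m
    ≡⟨ cong (_C suc m) (sym (even m)) ⟩
  (2 * suc m + 0) C suc m ∎
  where
  open ≡-Reasoning
  N = suc (2 * m)
  even : ∀ m → 2 * suc m + 0 ≡ suc (suc (2 * m))
  even = solve-∀
  odd : ∀ m → 2 * m + 1 ≡ suc (2 * m)
  odd = solve-∀
  reflected : ballot m 1 + N C⁻ m ≡ N C m
  reflected = subst (λ s → ballot m 1 + s C⁻ m ≡ s C m) (odd m) (ballot-reflection m 1)
ballot-reflection (suc m) (suc j) = begin
  ballot m (2 + j) + ballot (suc m) j + (2 * suc m + suc j) C m
    ≡⟨ cong (λ s → ballot m (2 + j) + ballot (suc m) j + s C m) (shift m j) ⟩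
  ballot m (2 + j) + ballot (suc m) j + suc N C m
    ≡⟨ cong (ballot m (2 + j) + ballot (suc m) j +_) (sym (C⁻-pascal N m)) ⟩
  ballot m (2 + j) + ballot (suc m) j + (N C⁻ m + N C m)
    ≡⟨ interchange (ballot m (2 + j)) (ballot (suc m) j) (N C⁻ m) (N C m) ⟩
  (ballot m (2 + j) + N C⁻ m) + (ballot (suc m) j + N C m)
    ≡⟨ cong₂ _+_
         (subst (λ s → ballot m (2 + j) + s C⁻ m ≡ s C m) (left m j) (ballot-reflection m (2 + j)))
         (ballot-reflection (suc m) j) ⟩
  N C m + N C suc m
    ≡⟨ nCk+nC[k+1]≡[n+1]C[k+1] N m ⟩
  suc N C suc m
    ≡⟨ cong (_C suc m) (sym (shift m j)) ⟩
  (2 * suc m + suc j) C suc m ∎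
  where
  open ≡-Reasoning
  N = 2 * suc m + j
  shift : ∀ m j → 2 * suc m + suc j ≡ suc (2 * suc m + j)
  shift = solve-∀
  left : ∀ m j → 2 * m + (2 + j) ≡ 2 * suc m + j
  left = solve-∀
  interchange : ∀ a b c d → a + b + (c + d) ≡ (a + c) + (b + d)
  interchange = solve-∀

-- With a and b the entries m - 1 and m of row 2m, absorption gives m b = (m + 1) a. Hence (b - a)(m
-- + 1) = b, the equation that `catalan-exact` states for the Catalan number.
ballot-catalan : ∀ m → ballot m 0 ≡ catalan m
ballot-catalan zero      = refl
ballot-catalan m@(suc k) = ℕₚ.*-cancelʳ-≡ (ballot m 0) (catalan m) (suc m) (trans scaled (sym (catalan-exact m)))
  where
  open ≡-Reasoning
  a = (2 * m) C k
  b = (2 * m) C m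
  ratio : m * b ≡ suc m * a
  ratio = ℕₚ.+-cancelʳ-≡ (k * a) (m * b) (suc m * a) (trans (absorption (2 * m) k) (split k a))
    where
    split : ∀ k a → 2 * suc k * a ≡ suc (suc k) * a + k * a
    split = solve-∀
  reflected : ballot m 0 + a ≡ b
  reflected = subst (λ s → ballot m 0 + s C k ≡ s C m) (ℕₚ.+-identityʳ (2 * m)) (ballot-reflection m 0)
  scaled : ballot m 0 * suc m ≡ b
  scaled = ℕₚ.+-cancelʳ-≡ (suc m * a) _ _ (begin
    ballot m 0 * suc m + suc m * a  ≡⟨ factor (ballot m 0) m a ⟩
    suc m * (ballot m 0 + a)        ≡⟨ cong (suc m *_) reflected ⟩
    b + m * b                       ≡⟨ cong (b +_) ratio ⟩
    b + suc m * a                   ∎)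
    where
    factor : ∀ n m a → n * suc m + suc m * a ≡ suc m * (n + a)
    factor = solve-∀

-- The transfer operator over a commutative semiring.

module Transfer {c ℓ} (S : CommutativeSemiring c ℓ) where
  private module S = CommutativeSemiring S
  open S using (Carrier; 1#; +-cong; +-congˡ; +-congʳ; *-cong; *-congˡ; *-congʳ)
    renaming (_+_ to _⊞_; _*_ to _⊠_; _≈_ to _≋_)
  open SemiringSolver S using (solve; _:+_; _:*_; _:=_; con)
  open SetoidReasoning S.setoid

  module Eigenbasis (y u z : Carrier) (u⊠z≋y : u ⊠ z ≋ y) (u⊞y≋1 : u ⊞ y ≋ 1#) where

    -- Explicitly, V_j(L) is the sum over i of (L choose i) z^(j-i), and the forward difference Δ in
    -- L takes V_{j+1} to V_j.
    V : ℕ → ℕ → Carrier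
    V zero    L       = 1#
    V (suc j) zero    = z ⊠ V j zero
    V (suc j) (suc L) = V (suc j) L ⊞ V j L

    -- The geometric series for (1 - z Δ)⁻¹ V_j, which is the finite sum of the z^i V_{j-i} because
    -- Δ V_0 = 0.
    U : ℕ → ℕ → Carrier
    U zero    L = V zero L
    U (suc j) L = V (suc j) L ⊞ z ⊠ U j L

    -- K m j = A^m V_j, and UK m j = (1 - z Δ)⁻¹ (K m j) for the forward
    -- difference Δ in L, where A is summation over L after (1 - z Δ)⁻¹.
    iterate : (ℕ → ℕ → Carrier) → ℕ → ℕ → ℕ → Carrier
    iterate B zero    j       L = B j L
    iterate B (suc m) zero    L = iterate B m 1 L
    iterate B (suc m) (suc j) L = iterate B m (2 + j) L ⊞ z ⊠ iterate B (suc m) j L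

    K UK : ℕ → ℕ → ℕ → Carrier
    K  = iterate V
    UK = iterate U

    -- With E the shift in L, 1 - y E = (1 - y)(1 - z Δ). So this is the equation (1 - z Δ) UK = K,
    -- multiplied by u = 1 - y and written without subtraction.
    UK-resolvent : ∀ m j L → u ⊠ K m j L ⊞ y ⊠ UK m j (suc L) ≋ UK m j L
    UK-resolvent zero zero L = begin
      u ⊠ 1# ⊞ y ⊠ 1#  ≈⟨ solve 2 (λ u y → u :* con 1 :+ y :* con 1 := u :+ y) S.refl u y ⟩
      u ⊞ y            ≈⟨ u⊞y≋1 ⟩
      1#               ∎
    UK-resolvent zero (suc j) L = begin
      u ⊠ a ⊞ y ⊠ ((a ⊞ b) ⊞ z ⊠ d)
        ≈⟨ solve 6 (λ u y z a b d → u :* a :+ y :* ((a :+ b) :+ z :* d)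
             := (u :+ y) :* a :+ (y :* b :+ z :* (y :* d))) S.refl u y z a b d ⟩
      (u ⊞ y) ⊠ a ⊞ (y ⊠ b ⊞ z ⊠ (y ⊠ d))
        -- u + y = 1 restores V_{j+1}, and y = u z brings the rest into the form of the equation for
        -- j.
        ≈⟨ +-cong (*-congʳ u⊞y≋1) (+-congʳ (*-congʳ (S.sym u⊠z≋y))) ⟩
      1# ⊠ a ⊞ (u ⊠ z ⊠ b ⊞ z ⊠ (y ⊠ d))
        ≈⟨ solve 6 (λ u y z a b d → con 1 :* a :+ (u :* z :* b :+ z :* (y :* d))
             := a :+ z :* (u :* b :+ y :* d)) S.refl u y z a b d ⟩
      a ⊞ z ⊠ (u ⊠ b ⊞ y ⊠ d)
        ≈⟨ +-congˡ (*-congˡ (UK-resolvent zero j L)) ⟩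
      a ⊞ z ⊠ U j L ∎
      where
      a = V (suc j) L
      b = V j L
      d = U j (suc L)
    UK-resolvent (suc m) zero L = UK-resolvent m 1 L
    UK-resolvent (suc m) (suc j) L = begin
      u ⊠ (a ⊞ z ⊠ a′) ⊞ y ⊠ (b ⊞ z ⊠ b′)
        ≈⟨ solve 7 (λ u y z a a′ b b′ → u :* (a :+ z :* a′) :+ y :* (b :+ z :* b′)
             := (u :* a :+ y :* b) :+ z :* (u :* a′ :+ y :* b′)) S.refl u y z a a′ b b′ ⟩
      (u ⊠ a ⊞ y ⊠ b) ⊞ z ⊠ (u ⊠ a′ ⊞ y ⊠ b′)
        ≈⟨ +-cong (UK-resolvent m (2 + j) L) (*-congˡ (UK-resolvent (suc m) j L)) ⟩
      UK m (2 + j) L ⊞ z ⊠ UK (suc m) j L ∎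
      where
      a = K m (2 + j) L
      a′ = K (suc m) j L
      b = UK m (2 + j) (suc L)
      b′ = UK (suc m) j (suc L)

    -- With `K-suc-suc` this describes A as summation over L of the resolvent, with initial value z
    -- times the resolvent at 0. Both sides obey the linear recursion of `iterate`, so the induction
    -- comes down to V_0.
    K-suc-zero : ∀ m j → K (suc m) j 0 ≋ z ⊠ UK m j 0
    K-suc-zero zero    zero    = S.refl
    K-suc-zero zero    (suc j) = S.trans (+-congˡ (*-congˡ (K-suc-zero zero j))) (S.sym (S.distribˡ z _ _))
    K-suc-zero (suc m) zero    = K-suc-zero m 1
    K-suc-zero (suc m) (suc j) =
      S.trans (+-cong (K-suc-zero m (2 + j)) (*-congˡ (K-suc-zero (suc m) j))) (S.sym (S.distribˡ z _ _))

    private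
      regroup : ∀ a b d e → (a ⊞ b) ⊞ z ⊠ (d ⊞ e) ≋ (a ⊞ z ⊠ d) ⊞ (b ⊞ z ⊠ e)
      regroup = solve 5 (λ z a b d e → (a :+ b) :+ z :* (d :+ e)
        := (a :+ z :* d) :+ (b :+ z :* e)) S.refl z

    K-suc-suc : ∀ m j L → K (suc m) j (suc L) ≋ K (suc m) j L ⊞ UK m j L
    K-suc-suc zero    zero    L = S.refl
    K-suc-suc zero    (suc j) L = S.trans (+-congˡ (*-congˡ (K-suc-suc zero j L))) (regroup _ _ _ _)
    K-suc-suc (suc m) zero    L = K-suc-suc m 1 L
    K-suc-suc (suc m) (suc j) L =
      S.trans (+-cong (K-suc-suc m (2 + j) L) (*-congˡ (K-suc-suc (suc m) j L))) (regroup _ _ _ _)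

    -- At L = 0 every V_j is a power of z, so the recursion of `K` becomes that of `ballot` times a
    -- common power. `ι` maps the natural numbers into the semiring.
    K-zero : (ι : ℕ → Carrier) → ι 1 ≋ 1# → (∀ a b → ι (a + b) ≋ ι a ⊞ ι b) →
      ∀ m j → K m j 0 ≋ ι (ballot m j) ⊠ V (m + j) 0
    K-zero ι ι-one ι-+ = go
      where
      go : ∀ m j → K m j 0 ≋ ι (ballot m j) ⊠ V (m + j) 0
      go zero j = S.trans (S.sym (S.*-identityˡ _)) (*-congʳ (S.sym ι-one))
      go (suc m) zero = S.trans (go m 1) (*-congˡ (S.reflexive (cong (λ s → V s 0) (ℕₚ.+-suc m 0))))
      go (suc m) (suc j) = begin
        K m (2 + j) 0 ⊞ z ⊠ K (suc m) j 0
          ≈⟨ +-cong (go m (2 + j)) (*-congˡ (go (suc m) j)) ⟩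
        a ⊠ V (m + (2 + j)) 0 ⊞ z ⊠ (b ⊠ V (suc m + j) 0)
          ≈⟨ +-congʳ (*-congˡ (S.reflexive (cong (λ s → V s 0) (shift m j)))) ⟩
        a ⊠ (z ⊠ v) ⊞ z ⊠ (b ⊠ v)
          ≈⟨ solve 4 (λ a b z v → a :* (z :* v) :+ z :* (b :* v) := (a :+ b) :* (z :* v)) S.refl a b z v ⟩
        (a ⊞ b) ⊠ (z ⊠ v)
          ≈⟨ *-congʳ (S.sym (ι-+ (ballot m (2 + j)) (ballot (suc m) j))) ⟩
        ι (ballot (suc m) (suc j)) ⊠ V (suc (suc m + j)) 0
          ≈⟨ *-congˡ (S.reflexive (cong (λ s → V s 0) (sym (ℕₚ.+-suc (suc m) j)))) ⟩
        ι (ballot (suc m) (suc j)) ⊠ V (suc m + suc j) 0 ∎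
        where
        a = ι (ballot m (2 + j))
        b = ι (ballot (suc m) j)
        v = V (suc m + j) 0
        shift : ∀ m j → m + (2 + j) ≡ suc (suc m + j)
        shift = solve-∀

-- Formal power series

open import Data.Integer as ℤ using (+_; 0ℤ; 1ℤ)
import Data.Integer.Properties as ℤₚ
open import Data.Integer.Tactic.RingSolver using () renaming (solve-∀ to ℤ-solve-∀)

⊛-cong : ∀ {f f′ g g′} → f ≈ f′ → g ≈ g′ → f ⊛ g ≈ f′ ⊛ g′
⊛-cong p q zero    = cong₂ ℤ._*_ (p 0) (q 0)
⊛-cong p q (suc n) = cong₂ ℤ._+_ (cong₂ ℤ._*_ (p 0) (q (suc n))) (⊛-cong (p ∘ suc) q n)

⊛-zeroˡ : ∀ f → const 0ℤ ⊛ f ≈ const 0ℤ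
⊛-zeroˡ f zero    = refl
⊛-zeroˡ f (suc n) = trans (ℤₚ.+-identityˡ _) (vanish n)
  where
  const-zero : ∀ n → const 0ℤ n ≡ 0ℤ
  const-zero zero    = refl
  const-zero (suc n) = refl
  -- The tail of `const 0ℤ` is `const 0ℤ` again only pointwise, so the recursion passes through
  -- `⊛-cong`.
  vanish : ∀ n → ((const 0ℤ ∘ suc) ⊛ f) n ≡ 0ℤ
  vanish n = trans (⊛-cong {g = f} (λ k → sym (const-zero k)) (λ _ → refl) n)
    (trans (⊛-zeroˡ f n) (const-zero n))

⊛-scaleˡ : ∀ a f → const a ⊛ f ≈ λ n → a ℤ.* f n
⊛-scaleˡ a f zero    = refl
⊛-scaleˡ a f (suc n) = trans
  (cong (λ t → a ℤ.* f (suc n) ℤ.+ t)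
    (trans (⊛-cong {g = f} tail (λ _ → refl) n) (trans (⊛-zeroˡ f n) (sym (tail n)))))
  (ℤₚ.+-identityʳ _)
  where
  tail : (const a ∘ suc) ≈ const 0ℤ
  tail zero    = refl
  tail (suc n) = refl

⊛-distribʳ : ∀ h f g → (f ⊕ g) ⊛ h ≈ f ⊛ h ⊕ g ⊛ h
⊛-distribʳ h f g zero    = ℤₚ.*-distribʳ-+ (h 0) (f 0) (g 0)
⊛-distribʳ h f g (suc n) =
  trans (cong (λ t → (f 0 ℤ.+ g 0) ℤ.* h (suc n) ℤ.+ t) (⊛-distribʳ h (f ∘ suc) (g ∘ suc) n))
        (regroup (f 0) (g 0) (h (suc n)) _ _)
  where
  regroup : ∀ a b c s t → (a ℤ.+ b) ℤ.* c ℤ.+ (s ℤ.+ t) ≡ (a ℤ.* c ℤ.+ s) ℤ.+ (b ℤ.* c ℤ.+ t)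
  regroup = ℤ-solve-∀

-- `sumTo` peels off the first summand; peeling off the last one instead turns commutativity into an
-- induction.
⊛-lastˡ : ∀ f g n → (f ⊛ g) (suc n) ≡ g 0 ℤ.* f (suc n) ℤ.+ (f ⊛ (g ∘ suc)) n
⊛-lastˡ f g zero    = swap (f 0) (f 1) (g 0) (g 1)
  where
  swap : ∀ a b c d → a ℤ.* d ℤ.+ b ℤ.* c ≡ c ℤ.* b ℤ.+ a ℤ.* d
  swap = ℤ-solve-∀
⊛-lastˡ f g (suc n) =
  trans (cong (λ t → f 0 ℤ.* g (2 + n) ℤ.+ t) (⊛-lastˡ (f ∘ suc) g n))
        (swap (f 0 ℤ.* g (2 + n)) (g 0 ℤ.* f (2 + n)) _)
  where
  swap : ∀ a b c → a ℤ.+ (b ℤ.+ c) ≡ b ℤ.+ (a ℤ.+ c)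
  swap = ℤ-solve-∀

⊛-comm : ∀ f g → f ⊛ g ≈ g ⊛ f
⊛-comm f g zero    = ℤₚ.*-comm (f 0) (g 0)
⊛-comm f g (suc n) = trans (⊛-lastˡ f g n) (cong (λ t → g 0 ℤ.* f (suc n) ℤ.+ t) (⊛-comm f (g ∘ suc) n))

⊛-scale-assoc : ∀ a f g → (λ n → a ℤ.* f n) ⊛ g ≈ λ n → a ℤ.* (f ⊛ g) n
⊛-scale-assoc a f g zero    = ℤₚ.*-assoc a (f 0) (g 0)
⊛-scale-assoc a f g (suc n) =
  trans (cong (λ t → a ℤ.* f 0 ℤ.* g (suc n) ℤ.+ t) (⊛-scale-assoc a (f ∘ suc) g n)) (factor a (f 0) (g (suc n)) _)
  where
  factor : ∀ a b c d → a ℤ.* b ℤ.* c ℤ.+ a ℤ.* d ≡ a ℤ.* (b ℤ.* c ℤ.+ d)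
  factor = ℤ-solve-∀

⊛-assoc : ∀ f g h → (f ⊛ g) ⊛ h ≈ f ⊛ (g ⊛ h)
⊛-assoc f g h zero    = ℤₚ.*-assoc (f 0) (g 0) (h 0)
⊛-assoc f g h (suc n) = begin
  -- The tail of `f ⊛ g` unfolds to `f 0` times the tail of `g`, plus the tail of `f` times `g`.
  f 0 ℤ.* g 0 ℤ.* h (suc n) ℤ.+ (((λ k → f 0 ℤ.* g (suc k)) ⊕ (f ∘ suc) ⊛ g) ⊛ h) n
    ≡⟨ cong (λ t → f 0 ℤ.* g 0 ℤ.* h (suc n) ℤ.+ t) (⊛-distribʳ h (λ k → f 0 ℤ.* g (suc k)) ((f ∘ suc) ⊛ g) n) ⟩
  f 0 ℤ.* g 0 ℤ.* h (suc n) ℤ.+ (((λ k → f 0 ℤ.* g (suc k)) ⊛ h) n ℤ.+ (((f ∘ suc) ⊛ g) ⊛ h) n)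
    ≡⟨ cong₂ (λ s t → f 0 ℤ.* g 0 ℤ.* h (suc n) ℤ.+ (s ℤ.+ t))
         (⊛-scale-assoc (f 0) (g ∘ suc) h n) (⊛-assoc (f ∘ suc) g h n) ⟩
  f 0 ℤ.* g 0 ℤ.* h (suc n) ℤ.+ (f 0 ℤ.* ((g ∘ suc) ⊛ h) n ℤ.+ ((f ∘ suc) ⊛ (g ⊛ h)) n)
    ≡⟨ factor (f 0) (g 0) (h (suc n)) _ _ ⟩
  f 0 ℤ.* (g 0 ℤ.* h (suc n) ℤ.+ ((g ∘ suc) ⊛ h) n) ℤ.+ ((f ∘ suc) ⊛ (g ⊛ h)) n ∎
  where
  open ≡-Reasoning
  factor : ∀ a b c d e → a ℤ.* b ℤ.* c ℤ.+ (a ℤ.* d ℤ.+ e) ≡ a ℤ.* (b ℤ.* c ℤ.+ d) ℤ.+ e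
  factor = ℤ-solve-∀

seriesSemiring : CommutativeSemiring 0ℓ 0ℓ
seriesSemiring = record
  { Carrier = Series
  ; _≈_ = _≈_
  ; _+_ = _⊕_
  ; _*_ = _⊛_
  ; 0# = const 0ℤ
  ; 1# = const 1ℤ
  ; isCommutativeSemiring = isCommutativeSemiringˡ (record
    { +-isCommutativeMonoid = record
      { isMonoid = record
        { isSemigroup = record
          { isMagma = record
            { isEquivalence = isEquivalence
            ; ∙-cong = λ p q k → cong₂ ℤ._+_ (p k) (q k)
            }
          ; assoc = λ f g h k → ℤₚ.+-assoc (f k) (g k) (h k)
          }
        ; identity = ⊕-identityˡ , λ f k → trans (ℤₚ.+-comm (f k) _) (⊕-identityˡ f k)
        }
      ; comm = λ f g k → ℤₚ.+-comm (f k) (g k)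
      }
    ; *-isCommutativeMonoid = record
      { isMonoid = record
        { isSemigroup = record
          { isMagma = record
            { isEquivalence = isEquivalence
            ; ∙-cong = λ {f} {f′} {g} {g′} → ⊛-cong {f} {f′} {g} {g′}
            }
          ; assoc = ⊛-assoc
          }
        ; identity = ⊛-identityˡ , λ f k → trans (⊛-comm f (const 1ℤ) k) (⊛-identityˡ f k)
        }
      ; comm = ⊛-comm
      }
    ; distribʳ = ⊛-distribʳ
    ; zeroˡ = ⊛-zeroˡ
    })
  }
  where
  isEquivalence : IsEquivalence _≈_
  isEquivalence = record
    { refl = λ _ → refl ; sym = λ p k → sym (p k) ; trans = λ p q k → trans (p k) (q k) }
  ⊕-identityˡ : ∀ f → const 0ℤ ⊕ f ≈ f
  ⊕-identityˡ f zero    = ℤₚ.+-identityˡ (f 0)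
  ⊕-identityˡ f (suc k) = ℤₚ.+-identityˡ (f (suc k))
  ⊛-identityˡ : ∀ f → const 1ℤ ⊛ f ≈ f
  ⊛-identityˡ f k = trans (⊛-scaleˡ 1ℤ f k) (ℤₚ.*-identityˡ (f k))


y⊛-suc : ∀ f n → (y ⊛ f) (suc n) ≡ f n
y⊛-suc f n = begin
  0ℤ ℤ.+ ((y ∘ suc) ⊛ f) n  ≡⟨ ℤₚ.+-identityˡ _ ⟩
  ((y ∘ suc) ⊛ f) n         ≡⟨ ⊛-cong {g = f} tail (λ _ → refl) n ⟩
  (const 1ℤ ⊛ f) n          ≡⟨ ⊛-scaleˡ 1ℤ f n ⟩
  1ℤ ℤ.* f n                ≡⟨ ℤₚ.*-identityˡ (f n) ⟩
  f n                       ∎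
  where
  open ≡-Reasoning
  tail : (y ∘ suc) ≈ const 1ℤ
  tail zero    = refl
  tail (suc k) = refl

-- The generating function

private module 𝕊 = CommutativeSemiring seriesSemiring
open SemiringSolver seriesSemiring using (solve; _:+_; _:*_; _:=_)

u z : Series
u = const 1ℤ ⊖ y
z = y ⊛ recip u

u⊛z≈y : u ⊛ z ≈ y
u⊛z≈y = begin
  u ⊛ (y ⊛ recip u)   ≈⟨ solve 3 (λ u y r → u :* (y :* r) := y :* (u :* r)) (λ _ → refl) u y (recip u) ⟩
  y ⊛ (u ⊛ recip u)   ≈⟨ 𝕊.*-congˡ {y} (recip-inverse u refl) ⟩
  y ⊛ const 1ℤ        ≈⟨ 𝕊.*-identityʳ y ⟩
  y                   ∎
  where open SetoidReasoning 𝕊.setoid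

u⊕y≈1 : u ⊕ y ≈ const 1ℤ
u⊕y≈1 k = cancel (const 1ℤ k) (y k)
  where
  cancel : ∀ a b → a ℤ.- b ℤ.+ b ≡ a
  cancel = ℤ-solve-∀

open Transfer seriesSemiring using (module Eigenbasis)
open Eigenbasis y u z u⊛z≈y u⊕y≈1

-- Recursions of the profile series in the level.

profileSeries climbSeries : ℕ → ℕ → Series
profileSeries m L n = + profiles m L n
climbSeries   m L n = + climbs m L n

rises-series : ∀ m L n → + rises m L n ≡ (y ⊛ climbSeries m L) n
rises-series m L zero    = refl
rises-series m L (suc n) = sym (y⊛-suc (climbSeries m L) n)

climbs-series : ∀ m L → climbSeries m L ≈ profileSeries m L ⊕ y ⊛ climbSeries m (suc L)
climbs-series m L zero    = sym (ℤₚ.+-identityʳ _)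
climbs-series m L (suc n) = trans (ℤₚ.pos-+ (profiles m L (suc n)) _)
  (cong (λ t → + profiles m L (suc n) ℤ.+ t) (sym (y⊛-suc (climbSeries m (suc L)) n)))

profiles-suc-zero : ∀ m → profileSeries (suc m) 0 ≈ y ⊛ climbSeries m 0
profiles-suc-zero m n = rises-series m 0 n

-- Let D and T be the series of descents and climbs from L. A rise from L costs 1 before its climb,
-- so level L gives D + y T. At level L + 1 a first level L is a descent and higher ones cost 1
-- less, which gives D + T; the difference is (1 - y) T.
profiles-suc-suc : ∀ m L → profileSeries (suc m) (suc L) ≈ profileSeries (suc m) L ⊕ u ⊛ climbSeries m L
profiles-suc-suc m L n = begin
  + (d + p + rises m (suc L) n)
    ≡⟨ trans (ℤₚ.pos-+ (d + p) _) (cong₂ ℤ._+_ (ℤₚ.pos-+ d p) (rises-series m (suc L) n)) ⟩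
  (+ d ℤ.+ + p) ℤ.+ (y ⊛ climbSeries m (suc L)) n
    ≡⟨ ℤₚ.+-assoc (+ d) (+ p) ((y ⊛ climbSeries m (suc L)) n) ⟩
  + d ℤ.+ (+ p ℤ.+ (y ⊛ climbSeries m (suc L)) n)
    ≡⟨ cong (λ t → + d ℤ.+ t) (trans (sym (climbs-series m L n)) (split n)) ⟩
  + d ℤ.+ ((u ⊛ t) n ℤ.+ (y ⊛ t) n)
    ≡⟨ regroup (+ d) ((u ⊛ t) n) ((y ⊛ t) n) ⟩
  (+ d ℤ.+ (y ⊛ t) n) ℤ.+ (u ⊛ t) n
    ≡⟨ cong (ℤ._+ (u ⊛ t) n) (trans (cong (λ s → + d ℤ.+ s) (sym (rises-series m L n))) (sym (ℤₚ.pos-+ d _))) ⟩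
  + (d + rises m L n) ℤ.+ (u ⊛ t) n ∎
  where
  open ≡-Reasoning
  d = descents m L n
  p = profiles m L n
  t = climbSeries m L
  split : t ≈ u ⊛ t ⊕ y ⊛ t
  split k = trans (sym (𝕊.*-identityˡ t k))
    (trans (sym (𝕊.*-congʳ {t} u⊕y≈1 k)) (𝕊.distribʳ t u y k))
  regroup : ∀ a b c → a ℤ.+ (b ℤ.+ c) ≡ (a ℤ.+ c) ℤ.+ b
  regroup = ℤ-solve-∀

-- Multiplication by y shifts coefficients, so X L n is determined by the
-- a L′ n′ with n′ ≤ n.
resolvent-unique : ∀ (a X X′ : ℕ → Series) →
  (∀ L → a L ⊕ y ⊛ X (suc L) ≈ X L) → (∀ L → a L ⊕ y ⊛ X′ (suc L) ≈ X′ L) → ∀ L → X L ≈ X′ L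
resolvent-unique a X X′ eq eq′ L zero    = trans (sym (eq L 0)) (eq′ L 0)
resolvent-unique a X X′ eq eq′ L (suc n) = trans (sym (eq L (suc n)))
  (trans (cong (λ t → a L (suc n) ℤ.+ t) shifted) (eq′ L (suc n)))
  where
  shifted : (y ⊛ X (suc L)) (suc n) ≡ (y ⊛ X′ (suc L)) (suc n)
  shifted = trans (y⊛-suc (X (suc L)) n)
    (trans (resolvent-unique a X X′ eq eq′ (suc L) n) (sym (y⊛-suc (X′ (suc L)) n)))

mutual
  -- The series and `K` have the same value at level 0 and the same differences in L, given the
  -- resolvent for one column fewer.
  profileSeries-K : ∀ m L → profileSeries m L ≈ K m 0 L
  profileSeries-K zero    L       zero    = refl
  profileSeries-K zero    L       (suc n) = refl
  profileSeries-K (suc m) zero    = begin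
    profileSeries (suc m) 0      ≈⟨ profiles-suc-zero m ⟩
    y ⊛ t                        ≈⟨ 𝕊.*-congʳ {t} (𝕊.sym {u ⊛ z} {y} u⊛z≈y) ⟩
    u ⊛ z ⊛ t                    ≈⟨ solve 3 (λ u z t → u :* z :* t := z :* (u :* t)) (λ _ → refl) u z t ⟩
    z ⊛ (u ⊛ t)                  ≈⟨ 𝕊.*-congˡ {z} (climbSeries-UK m 0) ⟩
    z ⊛ UK m 0 0                 ≈⟨ 𝕊.sym {K (suc m) 0 0} (K-suc-zero m 0) ⟩
    K (suc m) 0 0                ∎
    where
    open SetoidReasoning 𝕊.setoid
    t = climbSeries m 0
  profileSeries-K (suc m) (suc L) = begin
    profileSeries (suc m) (suc L)                 ≈⟨ profiles-suc-suc m L ⟩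
    profileSeries (suc m) L ⊕ u ⊛ climbSeries m L ≈⟨ 𝕊.+-cong {profileSeries (suc m) L} (profileSeries-K (suc m) L) (climbSeries-UK m L) ⟩
    K (suc m) 0 L ⊕ UK m 0 L                      ≈⟨ 𝕊.sym {K (suc m) 0 (suc L)} (K-suc-suc m 0 L) ⟩
    K (suc m) 0 (suc L)                           ∎
    where open SetoidReasoning 𝕊.setoid

  -- Multiplied by u, the choice between stopping at L and climbing on becomes the resolvent
  -- equation, whose solution is unique.
  climbSeries-UK : ∀ m L → u ⊛ climbSeries m L ≈ UK m 0 L
  climbSeries-UK m = resolvent-unique (λ L → u ⊛ K m 0 L) (λ L → u ⊛ climbSeries m L) (UK m 0)
    scaled (UK-resolvent m 0)
    where
    open SetoidReasoning 𝕊.setoid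
    scaled : ∀ L → u ⊛ K m 0 L ⊕ y ⊛ (u ⊛ climbSeries m (suc L)) ≈ u ⊛ climbSeries m L
    scaled L = begin
      u ⊛ K m 0 L ⊕ y ⊛ (u ⊛ t)
        ≈⟨ solve 4 (λ u y k t → u :* k :+ y :* (u :* t) := u :* (k :+ y :* t)) (λ _ → refl) u y (K m 0 L) t ⟩
      u ⊛ (K m 0 L ⊕ y ⊛ t)
        ≈⟨ 𝕊.*-congˡ {u} (𝕊.+-congʳ {y ⊛ t} (𝕊.sym {profileSeries m L} (profileSeries-K m L))) ⟩
      u ⊛ (profileSeries m L ⊕ y ⊛ t)
        ≈⟨ 𝕊.*-congˡ {u} (𝕊.sym {climbSeries m L} (climbs-series m L)) ⟩
      u ⊛ climbSeries m L ∎
      where t = climbSeries m (suc L)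

-- Catalan numbers and the closed form.

profileSeries-catalan : ∀ m → profileSeries m 0 ≈ const (+ catalan m) ⊛ z ^ˢ m
profileSeries-catalan m = begin
  profileSeries m 0                    ≈⟨ profileSeries-K m 0 ⟩
  K m 0 0                              ≈⟨ K-zero (const ∘ +_) (λ _ → refl) const-+ m 0 ⟩
  const (+ ballot m 0) ⊛ V (m + 0) 0   ≈⟨ 𝕊.*-cong {const (+ ballot m 0)}
                                            (𝕊.reflexive (cong (const ∘ +_) (ballot-catalan m)))
                                            (𝕊.trans {V (m + 0) 0} (V-zero (m + 0)) (𝕊.reflexive (cong (z ^ˢ_) (ℕₚ.+-identityʳ m)))) ⟩
  const (+ catalan m) ⊛ z ^ˢ m         ∎
  where
  open SetoidReasoning 𝕊.setoid
  const-+ : ∀ a b → const (+ (a + b)) ≈ const (+ a) ⊕ const (+ b)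
  const-+ a b zero    = ℤₚ.pos-+ a b
  const-+ a b (suc n) = refl
  V-zero : ∀ j → V j 0 ≈ z ^ˢ j
  V-zero zero    = 𝕊.refl {const 1ℤ}
  V-zero (suc j) = 𝕊.*-congˡ {z} (V-zero j)

-- From y = u z follows y^n = u^n z^n, and `u ^ˢ n` cancels against its reciprocal since its
-- constant term is 1.
y^⊘u^≈z^ : ∀ n → y ^ˢ n ⊘ u ^ˢ n ≈ z ^ˢ n
y^⊘u^≈z^ n = begin
  y ^ˢ n ⊛ r              ≈⟨ 𝕊.*-congʳ {r} (power n) ⟩
  u ^ˢ n ⊛ z ^ˢ n ⊛ r     ≈⟨ solve 3 (λ u z r → u :* z :* r := z :* (u :* r)) (λ _ → refl) (u ^ˢ n) (z ^ˢ n) r ⟩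
  z ^ˢ n ⊛ (u ^ˢ n ⊛ r)   ≈⟨ 𝕊.*-congˡ {z ^ˢ n} (recip-inverse (u ^ˢ n) (^ˢ-constant-term u n refl)) ⟩
  z ^ˢ n ⊛ const 1ℤ       ≈⟨ 𝕊.*-identityʳ (z ^ˢ n) ⟩
  z ^ˢ n                  ∎
  where
  open SetoidReasoning 𝕊.setoid
  r = recip (u ^ˢ n)
  power : ∀ n → y ^ˢ n ≈ u ^ˢ n ⊛ z ^ˢ n
  power zero    = 𝕊.sym {const 1ℤ ⊛ const 1ℤ} (𝕊.*-identityˡ (const 1ℤ))
  power (suc n) = begin
    y ⊛ y ^ˢ n                    ≈⟨ 𝕊.*-cong {y} (𝕊.sym {u ⊛ z} u⊛z≈y) (power n) ⟩
    u ⊛ z ⊛ (u ^ˢ n ⊛ z ^ˢ n)     ≈⟨ solve 4 (λ u z a b → u :* z :* (a :* b) := u :* a :* (z :* b)) (λ _ → refl) u z (u ^ˢ n) (z ^ˢ n) ⟩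
    u ⊛ u ^ˢ n ⊛ (z ⊛ z ^ˢ n)     ∎

generatingFunction-count : ∀ m →
  [x^ suc m ] generatingFunction count ≈ y ⊛ (profileSeries (suc m) 0 ⊕ profileSeries m 0)
generatingFunction-count m zero    = refl
generatingFunction-count m (suc n) =
  trans (ℤₚ.pos-+ (profiles (suc m) 0 n) _) (sym (y⊛-suc (profileSeries (suc m) 0 ⊕ profileSeries m 0) n))

theorem2p7 : Σ[ p ∈ (ℕ → ℕ → ℕ) ]
    (CountsFibonacciPolyominoes p
    × (∀ n → 1 ≤ n →
    [x^ n ] generatingFunction p
    ≈ (y ^ˢ n ⊘ (const 1ℤ ⊖ y) ^ˢ n)
    ⊛ (y ⊛ const (+ catalan n) ⊕ (const 1ℤ ⊖ y) ⊛ const (+ catalan (n ∸ 1)))))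
theorem2p7 = count , count-correct , coefficient
  where
  coefficient : ∀ n → 1 ≤ n → [x^ n ] generatingFunction count
    ≈ (y ^ˢ n ⊘ u ^ˢ n) ⊛ (y ⊛ const (+ catalan n) ⊕ u ⊛ const (+ catalan (n ∸ 1)))
  coefficient (suc m) _ = begin
    [x^ suc m ] generatingFunction count
      ≈⟨ generatingFunction-count m ⟩
    y ⊛ (profileSeries (suc m) 0 ⊕ profileSeries m 0)
      ≈⟨ 𝕊.*-congˡ {y} (𝕊.+-cong {profileSeries (suc m) 0} (profileSeries-catalan (suc m)) (profileSeries-catalan m)) ⟩
    y ⊛ (c′ ⊛ (z ⊛ v) ⊕ c ⊛ v)
      ≈⟨ solve 5 (λ y z v c c′ → y :* (c′ :* (z :* v) :+ c :* v)
           := (z :* v) :* (y :* c′) :+ y :* (v :* c)) (λ _ → refl) y z v c c′ ⟩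
    (z ⊛ v) ⊛ (y ⊛ c′) ⊕ y ⊛ (v ⊛ c)
      -- The second term has one factor z too few; replacing its y by u z supplies it and leaves the
      -- factor 1 - y.
      ≈⟨ 𝕊.+-congˡ {(z ⊛ v) ⊛ (y ⊛ c′)} (𝕊.*-congʳ {v ⊛ c} (𝕊.sym {u ⊛ z} u⊛z≈y)) ⟩
    (z ⊛ v) ⊛ (y ⊛ c′) ⊕ (u ⊛ z) ⊛ (v ⊛ c)
      ≈⟨ solve 6 (λ y u z v c c′ → (z :* v) :* (y :* c′) :+ (u :* z) :* (v :* c)
           := (z :* v) :* (y :* c′ :+ u :* c)) (λ _ → refl) y u z v c c′ ⟩
    (z ⊛ v) ⊛ (y ⊛ c′ ⊕ u ⊛ c)
      ≈⟨ 𝕊.*-congʳ {y ⊛ c′ ⊕ u ⊛ c} (𝕊.sym {y ^ˢ suc m ⊘ u ^ˢ suc m} (y^⊘u^≈z^ (suc m))) ⟩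
    (y ^ˢ suc m ⊘ u ^ˢ suc m) ⊛ (y ⊛ c′ ⊕ u ⊛ c) ∎
    where
    open SetoidReasoning 𝕊.setoid
    v  = z ^ˢ m
    c  = const (+ catalan m)
    c′ = const (+ catalan (suc m))
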